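{- Let $(G,X,H,f)$ be a constructible configuration. Then the following statements hold: (a) $\sum_{x\in X_v}f(x)=d_G(v)$ for all $v\in V(G)$. (b) $(G,X,H,f)$ is uncolorable.
   Context: $\mathbb{N}=\{1,2,\dots\}$, $\mathbb{N}_0=\mathbb{N}\cup\{0\}$. Graphs are finite, undirected, may have multiple edges, no loops; connected graphs are non-empty. $\mu_G(u,v)$ is the number of edges joining $u,v$; $d_G(v)$ is the number of edges incident with $v$. $tG$ has vertex set $V(G)$ and $\mu_{tG}=t\mu_G$. $K_n$, $C_n$ ($n\ge3$), $K_{s,s}$ are the simple complete graph, cycle, complete bipartite graph. A graph is a block if it is connected, non-empty and has no vertex whose deletion leaves at least two components. Covers. A cover of $G$ is a pair $(X,H)$, $H$ a graph, $X$ assigning to each $v\in V(G)$ a set $X_v\subseteq V(H)$, such that the $X_v$ are pairwise disjoint with union $V(H)$, each $X_v$ is independent in $H$, and for distinct $u,v\in V(G)$ the set of edges of $H$ between $X_u$ and $X_v$ is the union of $\mu_G(u,v)$ (possibly empty) matchings. A transversal is a set $T\subseteq V(H)$ with $|T\cap X_v|=1$ for all $v$. For $U\subseteq V(H)$ put $X_v(U)=X_v\cap U$; $(X,H)/U$ is the cover $(X',H[U])$ of $G[\{v: X_v(U)\ne\varnothing\}]$ with $X'_v=X_v(U)$. Configurations. A configuration is a tuple $(G,X,H,f)$ with $(X,H)$ a cover of the graph $G$ and $f:V(H)\to\mathbb{N}_0$. It is uniform if for some $r\ge1$ all $|X_v|=r$. A subgraph $\tilde H$ of $H$ is strictly $f$-degenerate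 if each non-empty subgraph $H'$ of $\tilde H$ has a vertex $x$ with $d_{H'}(x)<f(x)$. The configuration is colorable if $(X,H)$ has a transversal $T$ with $H[T]$ strictly $f$-degenerate, otherwise uncolorable. Special covers (all up to renaming vertices of the cover graph). A $G$-cover is a cover with $X_v=\{x_v\}$ for all $v$ and $\mu_H(x_u,x_v)=\mu_G(u,v)$ for all distinct $u,v$. For $G=tC_n$ with $C_n=(v_1,\dots,v_n,v_1)$, a double $G$-cover is a cover with $X_{v_i}=\{x_i,x_{n+i}\}$ ($1\le i\le n$), $\mu_H(x_i,x_j)=t$ if $i-j\equiv\pm1 \pmod{2n}$ and $\mu_H(x_i,x_j)=0$ otherwise. If $s\in\mathbb{N}$ divides all multiplicities $\mu_H(x,y)$, the $s$-inflation of $(X,H)$ is the cover $(\tilde X,\tilde H)$ of $G$ obtained by replacing every $x\in V(H)$ by a set $U_x$ of $s$ new vertices, with $\tilde X_v=\bigcup_{x\in X_v}U_x$, and for distinct $x,y\in V(H)$ placing a copy of $mK_{s,s}$ with parts $U_x,U_y$, where $m=\mu_H(x,y)/s$. An inflation is an $s$-inflation for some $s\in\mathbb{N}$. Constructible configurations. The family of constructible configurations is defined recursively: a uniform configuration $(G,X,H,f)$ is constructible if one of the following holds. (K1) M-configuration: $G$ is a block and there is $U\subseteq V(H)$ such that $(X,H)/U$ is an inflation of a $G$-cover, and for $v\in V(G)$, $x\in X_v$: $f(x)=d_G(v)/|X_v(U)|$ if $x\in U$, else $f(x)=0$. (K2) K-configuration: $G=tK_n$ with $t,n\in\mathbb{N}$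 and there are $p\ge1$, $n_1,\dots,n_p\in\mathbb{N}$ with $n_1+\dots+n_p=n-1$ and pairwise disjoint $U_1,\dots,U_p\subseteq V(H)$ such that each $(X,H)/U_i$ is an inflation of a $G$-cover, and for $v\in V(G)$, $x\in X_v$: $f(x)=tn_i/|X_v(U_i)|$ if $x\in U_i$ for some $i$, else $f(x)=0$. (K3) Odd C-configuration: $G=tC_n$ with $t\in\mathbb{N}$, $n\ge3$ odd, and there are disjoint $U_1,U_2\subseteq V(H)$ such that each $(X,H)/U_i$ is an inflation of a $G$-cover, and for $v\in V(G)$, $x\in X_v$: $f(x)=t/|X_v(U_i)|$ if $x\in U_i$ for $i\in\{1,2\}$, else $f(x)=0$. (K4) Even C-configuration: $G=tC_n$ with $t\in\mathbb{N}$, $n\ge4$ even, and there is $U\subseteq V(H)$ such that $(X,H)/U$ is an inflation of a double $G$-cover, and for $v\in V(G)$, $x\in X_v$: $f(x)=2t/|X_v(U)|$ if $x\in U$, else $f(x)=0$. (K5) There are two disjoint constructible configurations $(G^1,X^1,H^1,f^1)$, $(G^2,X^2,H^2,f^2)$ such that $G$ is obtained from the disjoint graphs $G^1,G^2$ by identifying a vertex $v^1\in V(G^1)$ and a vertex $v^2\in V(G^2)$ to a new vertex $v^*$; $H$ is obtained from the disjoint graphs $H^1,H^2$ by choosing a bijection $\pi:X^1_{v^1}\to X^2_{v^2}$ and identifying each $x\in X^1_{v^1}$ with $\pi(x)$ to a vertex $x^*$ (so $X_{v^*}$ is the set of these $x^*$, and $X_v=X^i_v$ for other $v\in V(G^i)$);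 and $f(y)=f^i(y)$ for $y\in V(H^i)\setminus X^i_{v^i}$, $f(x^*)=f^1(x)+f^2(\pi(x))$ for $x\in X^1_{v^1}$. -}

module Defs where

import Algebra.Properties.CommutativeMonoid.Sum
open import Data.Bool using (Bool; true; false; if_then_else_; _∧_; T)
open import Data.Bool.Properties using (∧-comm)
open import Data.Empty using (⊥-elim)
open import Data.Fin using (Fin; toℕ; _↑ˡ_; _↑ʳ_; _≟_)
open import Data.Fin.Properties using (nonZeroIndex; toℕ<n)
open import Data.Fin.Subset
  using (Subset; _∈_; _∉_; _⊆_; _∩_; _∪_; ∁; ⁅_⁆; ∣_∣; Nonempty; Empty; ⊤)
open import Data.Nat using (ℕ; suc; _+_; _*_; _∸_; _≤_; _<_; _≥_; z≤n; s≤s)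
open import Data.Nat.Divisibility using (_∣_; _∤_)
open import Data.Nat.DivMod using (_%_; m<n⇒m%n≡m; n%n≡0)
open import Data.Nat.Properties using (+-0-commutativeMonoid; ≤-refl; m≤n⇒m<n∨m≡n; 1+n≢n; *-zeroʳ)
import Data.Nat.Properties as ℕₚ
open import Data.Product using (Σ-syntax; ∃-syntax; _×_; _,_; proj₁; proj₂)
open import Data.Sum using (_⊎_; inj₁; inj₂; swap)
open import Data.Vec using (lookup)
open import Function.Bundles using (_⇔_; _↔_; mk⇔; module Inverse)
open import Function.Definitions using (Injective)
open import Relation.Binary.Construct.Closure.ReflexiveTransitive using (Star)
open import Relation.Binary.PropositionalEquality
  using (_≡_; _≢_; refl; sym; trans; cong; subst)
open import Relation.Nullary using (¬_; Dec; yes; no; does)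
open import Relation.Nullary.Decidable using (_⊎-dec_; does-⇔; dec-false)

open Algebra.Properties.CommutativeMonoid.Sum +-0-commutativeMonoid using (sum)

sumOver : ∀ {n} → Subset n → (Fin n → ℕ) → ℕ
sumOver S f = sum λ x → if lookup S x then f x else 0

------------------------------------------------------------------------
-- Multigraphs

-- Edges joining x and y are told apart by an index k < μ x y; only the
-- multiplicities are recorded.
record Graph : Set where
  field
    order    : ℕ
    μ        : Fin order → Fin order → ℕ
    μ-sym    : ∀ u v → μ u v ≡ μ v u
    loopless : ∀ v → μ v v ≡ 0

open Graph public

V : Graph → Set
V G = Fin (order G)

VSet : Graph → Set
VSet G = Subset (order G)

degree : (G : Graph) → V G → ℕ
degree G v = sum (μ G v)

-- Every edge joining x and y occurs in both orientations, (x , y , k) and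
-- (y , x , k).
Edge : Graph → Set
Edge G = Σ[ x ∈ V G ] Σ[ y ∈ V G ] Fin (μ G x y)

tail head : {G : Graph} → Edge G → V G
tail e = proj₁ e
head e = proj₁ (proj₂ e)

-- u and v are joined by a walk in G[W].
Linked : (G : Graph) → VSet G → V G → V G → Set
Linked G W = Star λ u v → u ∈ W × v ∈ W × 0 < μ G u v

Connected : Graph → Set
Connected G = 1 ≤ order G × (∀ u v → Linked G ⊤ u v)

-- G[W] has at least two components.
Disconnects : (G : Graph) → VSet G → Set
Disconnects G W = ∃[ u ] ∃[ v ] (u ∈ W × v ∈ W × ¬ Linked G W u v)

Block : Graph → Set
Block G = Connected G × ¬ (∃[ v ] Disconnects G (∁ ⁅ v ⁆))

record _≅_ (G G′ : Graph) : Set where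
  field
    bijection : V G ↔ V G′
    μ-pres    : ∀ u v → μ G′ (Inverse.to bijection u) (Inverse.to bijection v) ≡ μ G u v

infix 4 _≅_
infixr 7 _·_

_·_ : ℕ → Graph → Graph
t · G = record
  { order    = order G
  ; μ        = λ u v → t * μ G u v
  ; μ-sym    = λ u v → cong (t *_) (μ-sym G u v)
  ; loopless = λ v → trans (cong (t *_) (loopless G v)) (*-zeroʳ t)
  }

complete : ℕ → Graph
complete n = record
  { order    = n
  ; μ        = λ u v → if does (u ≟ v) then 0 else 1
  ; μ-sym    = λ u v → cong (λ b → if b then 0 else 1)
                         (does-⇔ (mk⇔ sym sym) (u ≟ v) (v ≟ u))
  ; loopless = diagonal
  }
  where
  diagonal : (v : Fin n) → (if does (v ≟ v) then 0 else 1) ≡ 0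
  diagonal v with v ≟ v
  ... | yes _   = refl
  ... | no v≢v = ⊥-elim (v≢v refl)

-- i - j ≡ ±1 (mod m)
CyclicallyAdjacent : ∀ {m} → Fin m → Fin m → Set
CyclicallyAdjacent {m} i j = next i j ⊎ next j i
  where
  next : Fin m → Fin m → Set
  next i j = (suc (toℕ i) % m) {{nonZeroIndex i}} ≡ toℕ j

cyclicallyAdjacent? : ∀ {m} (i j : Fin m) → Dec (CyclicallyAdjacent i j)
cyclicallyAdjacent? i j = (_ ℕₚ.≟ _) ⊎-dec (_ ℕₚ.≟ _)

cycle : (n : ℕ) → n ≥ 3 → Graph
cycle n n≥3 = record
  { order    = n
  ; μ        = λ u v → if does (cyclicallyAdjacent? u v) then 1 else 0
  ; μ-sym    = λ u v → cong (λ b → if b then 1 else 0)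
                         (does-⇔ (mk⇔ swap swap)
                           (cyclicallyAdjacent? u v) (cyclicallyAdjacent? v u))
  ; loopless = λ v → cong (λ b → if b then 1 else 0)
                       (dec-false (cyclicallyAdjacent? v v) (irrefl v))
  }
  where
  no-fixed-point : (v : Fin n) → (suc (toℕ v) % n) {{nonZeroIndex v}} ≢ toℕ v
  no-fixed-point v eq with m≤n⇒m<n∨m≡n (toℕ<n v)
  ... | inj₁ lt = 1+n≢n (trans (sym (m<n⇒m%n≡m {{nonZeroIndex v}} lt)) eq)
  ... | inj₂ e  = contra (subst (3 ≤_) n≡1 n≥3)
    where
    0≡v : 0 ≡ toℕ v
    0≡v = trans (sym (n%n≡0 n {{nonZeroIndex v}}))
            (trans (cong (λ k → (k % n) {{nonZeroIndex v}}) (sym e)) eq)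
    n≡1 : n ≡ 1
    n≡1 = trans (sym e) (cong suc (sym 0≡v))
    contra : ¬ (3 ≤ 1)
    contra (s≤s ())

  irrefl : (v : Fin n) → ¬ CyclicallyAdjacent v v
  irrefl v (inj₁ p) = no-fixed-point v p
  irrefl v (inj₂ p) = no-fixed-point v p

------------------------------------------------------------------------
-- Subgraphs

record Subgraph (H : Graph) : Set where
  field
    vertices : VSet H
    mult     : V H → V H → ℕ
    mult-sym : ∀ x y → mult x y ≡ mult y x
    mult≤μ   : ∀ x y → mult x y ≤ μ H x y
    support  : ∀ x y → x ∉ vertices → mult x y ≡ 0

open Subgraph public

_⊑_ : {H : Graph} → Subgraph H → Subgraph H → Set
K ⊑ L = vertices K ⊆ vertices L × (∀ x y → mult K x y ≤ mult L x y)

subdegree : {H : Graph} → Subgraph H → V H → ℕ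
subdegree K x = sum (mult K x)

induced : (H : Graph) → VSet H → Subgraph H
induced H S = record
  { vertices = S
  ; mult     = λ x y → if lookup S x ∧ lookup S y then μ H x y else 0
  ; mult-sym = symm
  ; mult≤μ   = λ x y → bound (lookup S x ∧ lookup S y)
  ; support  = supp
  }
  where
  open import Data.Vec.Properties using (lookup⇒[]=)

  symm : ∀ x y → (if lookup S x ∧ lookup S y then μ H x y else 0)
               ≡ (if lookup S y ∧ lookup S x then μ H y x else 0)
  symm x y rewrite ∧-comm (lookup S x) (lookup S y) | μ-sym H x y = refl

  bound : ∀ b {m} → (if b then m else 0) ≤ m
  bound true  = ≤-refl
  bound false = z≤n

  supp : ∀ x y → x ∉ S → (if lookup S x ∧ lookup S y then μ H x y else 0) ≡ 0
  supp x y x∉S with lookup S x in eq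
  ... | true  = ⊥-elim (x∉S (lookup⇒[]= x S eq))
  ... | false = refl

StrictlyDegenerate : {H : Graph} → (V H → ℕ) → Subgraph H → Set
StrictlyDegenerate {H} f K =
  (K′ : Subgraph H) → K′ ⊑ K → Nonempty (vertices K′) →
  ∃[ x ] (x ∈ vertices K′ × subdegree K′ x < f x)

------------------------------------------------------------------------
-- Covers

record Cover (G : Graph) : Set where
  field
    H           : Graph
    X           : V G → VSet H
    disjoint    : ∀ u v x → x ∈ X u → x ∈ X v → u ≡ v
    exhaustive  : ∀ x → ∃[ v ] (x ∈ X v)
    independent : ∀ v x y → x ∈ X v → y ∈ X v → μ H x y ≡ 0
    matching    : ∀ u v → u ≢ v → Fin (μ G u v) → Edge H → Bool
    -- The edges between X u and X v, oriented from X u to X v, are the union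
    -- of the sets M i, M = matching u v u≢v.
    union       : ∀ u v (u≢v : u ≢ v) (e : Edge H) →
                  (tail {H} e ∈ X u × head {H} e ∈ X v)
                    ⇔ (∃[ i ] T (matching u v u≢v i e))
    -- Since X u and X v are disjoint, edges oriented from X u to X v share an
    -- endpoint only if they share their tail or their head.
    isMatching  : ∀ u v (u≢v : u ≢ v) i (e e′ : Edge H) →
                  T (matching u v u≢v i e) → T (matching u v u≢v i e′) →
                  tail {H} e ≡ tail {H} e′ ⊎ head {H} e ≡ head {H} e′ → e ≡ e′

open Cover public using (H; X)

IsTransversal : {G : Graph} (C : Cover G) → VSet (H C) → Set
IsTransversal C S = ∀ v → ∣ S ∩ X C v ∣ ≡ 1

-- D is, up to renaming the vertices of the cover graph, the cover (X,H)/U, and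
-- the base graph G[{v : X_v(U) ≠ ∅}] of the latter is the whole of G.
record IsRestriction {G : Graph} (C : Cover G) (U : VSet (H C)) (D : Cover G) : Set where
  field
    full      : ∀ v → Nonempty (X C v ∩ U)
    bijection : V (H D) ↔ (∃[ x ] (x ∈ U))

  ι : V (H D) → V (H C)
  ι a = proj₁ (Inverse.to bijection a)

  field
    fibres    : ∀ v a → a ∈ X D v ⇔ ι a ∈ X C v
    μ-induced : ∀ a b → μ (H D) a b ≡ μ (H C) (ι a) (ι b)

IsGCover : {G : Graph} → Cover G → Set
IsGCover {G} C =
  Σ[ x ∈ (V G → V (H C)) ]
    (∀ v → X C v ≡ ⁅ x v ⁆) ×
    (∀ u v → u ≢ v → μ (H C) (x u) (x v) ≡ μ G u v)

-- σ fixes the enumeration v₁, …, vₙ of the cycle; the vertices x₁, …, x₂ₙ are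
-- indexed from 0, so i ↑ˡ n and n ↑ʳ i are the two vertices over the i-th one.
IsDoubleCover : {G : Graph} (t n : ℕ) (n≥3 : n ≥ 3) → t · cycle n n≥3 ≅ G → Cover G → Set
IsDoubleCover t n n≥3 σ C =
  Σ[ x ∈ (Fin (n + n) → V (H C)) ]
    Injective _≡_ _≡_ x ×
    (∀ i → X C (Inverse.to (_≅_.bijection σ) i) ≡ ⁅ x (i ↑ˡ n) ⁆ ∪ ⁅ x (n ↑ʳ i) ⁆) ×
    (∀ i j → CyclicallyAdjacent i j → μ (H C) (x i) (x j) ≡ t) ×
    (∀ i j → ¬ CyclicallyAdjacent i j → μ (H C) (x i) (x j) ≡ 0)

-- D is the s-inflation of C: U_x = { vertex (x , k) | k < s }.  The equation
-- μ-inflated says that s divides μ(x,y) and that U_x, U_y span a copy of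
-- (μ(x,y)/s) K_{s,s}; for x = y it says that U_x is independent.
record IsInflationBy {G : Graph} (s : ℕ) (C D : Cover G) : Set where
  field
    s≥1       : s ≥ 1
    bijection : (V (H C) × Fin s) ↔ V (H D)

  vertex : V (H C) × Fin s → V (H D)
  vertex = Inverse.to bijection

  field
    fibres     : ∀ v x k → vertex (x , k) ∈ X D v ⇔ x ∈ X C v
    μ-inflated : ∀ x y k l → μ (H D) (vertex (x , k)) (vertex (y , l)) * s ≡ μ (H C) x y

IsInflation : {G : Graph} → (Cover G → Set) → Cover G → Set
IsInflation {G} P D = ∃[ s ] Σ[ C ∈ Cover G ] (P C × IsInflationBy s C D)

-- (X,H)/U is an inflation of a cover (of all of G) satisfying P.
RestrictsToInflation : {G : Graph} → (Cover G → Set) → (C : Cover G) → VSet (H C) → Set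
RestrictsToInflation {G} P C U = Σ[ D ∈ Cover G ] (IsRestriction C U D × IsInflation P D)

------------------------------------------------------------------------
-- Configurations

record Configuration : Set where
  field
    G     : Graph
    cover : Cover G
    f     : V (H cover) → ℕ

open Configuration public

-- The cover graph and the fibres of a configuration.
Hᶜ : Configuration → Graph
Hᶜ C = H (cover C)

Xᶜ : (C : Configuration) → V (G C) → VSet (Hᶜ C)
Xᶜ C = X (cover C)

Uniform : Configuration → Set
Uniform C = ∃[ r ] (r ≥ 1 × (∀ v → ∣ Xᶜ C v ∣ ≡ r))

Colorable : Configuration → Set
Colorable C =
  ∃[ S ] (IsTransversal (cover C) S × StrictlyDegenerate (f C) (induced (Hᶜ C) S))

Uncolorable : Configuration → Set
Uncolorable C = ¬ Colorable C

-- In the four base cases f(x) = a / |X_v(U)| is written f(x) · |X_v(U)| = a;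
-- here |X_v(U)| ≥ 1.

record MConfiguration (C : Configuration) : Set where
  field
    block     : Block (G C)
    U         : VSet (Hᶜ C)
    inflation : RestrictsToInflation IsGCover (cover C) U
    f-inside  : ∀ v x → x ∈ Xᶜ C v → x ∈ U → f C x * ∣ Xᶜ C v ∩ U ∣ ≡ degree (G C) v
    f-outside : ∀ x → x ∉ U → f C x ≡ 0

record KConfiguration (C : Configuration) : Set where
  field
    t n       : ℕ
    t≥1       : t ≥ 1
    n≥1       : n ≥ 1
    G≅tKₙ     : t · complete n ≅ G C
    p         : ℕ
    p≥1       : p ≥ 1
    ns        : Fin p → ℕ
    ns≥1      : ∀ i → ns i ≥ 1
    Σns       : sum ns ≡ n ∸ 1
    U         : Fin p → VSet (Hᶜ C)
    U-disj    : ∀ i j → i ≢ j → Empty (U i ∩ U j)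
    inflation : ∀ i → RestrictsToInflation IsGCover (cover C) (U i)
    f-inside  : ∀ i v x → x ∈ Xᶜ C v → x ∈ U i → f C x * ∣ Xᶜ C v ∩ U i ∣ ≡ t * ns i
    f-outside : ∀ x → (∀ i → x ∉ U i) → f C x ≡ 0

record OddCConfiguration (C : Configuration) : Set where
  field
    t n        : ℕ
    t≥1        : t ≥ 1
    n≥3        : n ≥ 3
    n-odd      : 2 ∤ n
    G≅tCₙ      : t · cycle n n≥3 ≅ G C
    U₁ U₂      : VSet (Hᶜ C)
    U-disj     : Empty (U₁ ∩ U₂)
    inflation₁ : RestrictsToInflation IsGCover (cover C) U₁
    inflation₂ : RestrictsToInflation IsGCover (cover C) U₂
    f-inside₁  : ∀ v x → x ∈ Xᶜ C v → x ∈ U₁ → f C x * ∣ Xᶜ C v ∩ U₁ ∣ ≡ t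
    f-inside₂  : ∀ v x → x ∈ Xᶜ C v → x ∈ U₂ → f C x * ∣ Xᶜ C v ∩ U₂ ∣ ≡ t
    f-outside  : ∀ x → x ∉ U₁ → x ∉ U₂ → f C x ≡ 0

record EvenCConfiguration (C : Configuration) : Set where
  field
    t n       : ℕ
    t≥1       : t ≥ 1
    n≥3       : n ≥ 3
    n≥4       : n ≥ 4
    n-even    : 2 ∣ n
    G≅tCₙ     : t · cycle n n≥3 ≅ G C
    U         : VSet (Hᶜ C)
    inflation : RestrictsToInflation (IsDoubleCover t n n≥3 G≅tCₙ) (cover C) U
    f-inside  : ∀ v x → x ∈ Xᶜ C v → x ∈ U → f C x * ∣ Xᶜ C v ∩ U ∣ ≡ 2 * t
    f-outside : ∀ x → x ∉ U → f C x ≡ 0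

-- C arises from disjoint copies of C₁ and C₂ by identifying v₁ with v₂ and
-- each x in the fibre of v₁ with π x in the fibre of v₂.  The maps i₁, i₂ and
-- j₁, j₂ send the vertices of the parts to their images after identification.
record IsMerge (C₁ C₂ C : Configuration) : Set where
  field
    v₁ : V (G C₁)
    v₂ : V (G C₂)

    i₁ : V (G C₁) → V (G C)
    i₂ : V (G C₂) → V (G C)
    i₁-injective : Injective _≡_ _≡_ i₁
    i₂-injective : Injective _≡_ _≡_ i₂
    i-exhaustive : ∀ w → (∃[ u ] (i₁ u ≡ w)) ⊎ (∃[ u ] (i₂ u ≡ w))
    i-identified : ∀ u w → i₁ u ≡ i₂ w ⇔ (u ≡ v₁ × w ≡ v₂)
    μG₁  : ∀ u w → μ (G C) (i₁ u) (i₁ w) ≡ μ (G C₁) u w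
    μG₂  : ∀ u w → μ (G C) (i₂ u) (i₂ w) ≡ μ (G C₂) u w
    μG₁₂ : ∀ u w → u ≢ v₁ → w ≢ v₂ → μ (G C) (i₁ u) (i₂ w) ≡ 0

    π : (∃[ x ] (x ∈ Xᶜ C₁ v₁)) ↔ (∃[ y ] (y ∈ Xᶜ C₂ v₂))

    j₁ : V (Hᶜ C₁) → V (Hᶜ C)
    j₂ : V (Hᶜ C₂) → V (Hᶜ C)
    j₁-injective : Injective _≡_ _≡_ j₁
    j₂-injective : Injective _≡_ _≡_ j₂
    j-exhaustive : ∀ z → (∃[ x ] (j₁ x ≡ z)) ⊎ (∃[ y ] (j₂ y ≡ z))
    j-identified : ∀ x y → j₁ x ≡ j₂ y ⇔
                     (Σ[ x∈ ∈ x ∈ Xᶜ C₁ v₁ ] proj₁ (Inverse.to π (x , x∈)) ≡ y)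
    μH₁  : ∀ x y → μ (Hᶜ C) (j₁ x) (j₁ y) ≡ μ (Hᶜ C₁) x y
    μH₂  : ∀ x y → μ (Hᶜ C) (j₂ x) (j₂ y) ≡ μ (Hᶜ C₂) x y
    μH₁₂ : ∀ x y → x ∉ Xᶜ C₁ v₁ → y ∉ Xᶜ C₂ v₂ → μ (Hᶜ C) (j₁ x) (j₂ y) ≡ 0

    X₁ : ∀ v x → j₁ x ∈ Xᶜ C (i₁ v) ⇔ x ∈ Xᶜ C₁ v
    X₂ : ∀ v y → j₂ y ∈ Xᶜ C (i₂ v) ⇔ y ∈ Xᶜ C₂ v

    f₁ : ∀ x → x ∉ Xᶜ C₁ v₁ → f C (j₁ x) ≡ f C₁ x
    f₂ : ∀ y → y ∉ Xᶜ C₂ v₂ → f C (j₂ y) ≡ f C₂ y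
    f* : ∀ x (x∈ : x ∈ Xᶜ C₁ v₁) →
         f C (j₁ x) ≡ f C₁ x + f C₂ (proj₁ (Inverse.to π (x , x∈)))

data Constructible : Configuration → Set where
  M-conf    : ∀ {C} → Uniform C → MConfiguration C → Constructible C
  K-conf    : ∀ {C} → Uniform C → KConfiguration C → Constructible C
  oddCConf  : ∀ {C} → Uniform C → OddCConfiguration C → Constructible C
  evenCConf : ∀ {C} → Uniform C → EvenCConfiguration C → Constructible C
  merge     : ∀ {C₁ C₂ C} → Uniform C → Constructible C₁ → Constructible C₂ →
              IsMerge C₁ C₂ C → Constructible C

{-# OPTIONS --safe #-}

-- For (b), every choice τ of one vertex per fibre admits a non-empty set W of
-- vertices of G such that each x ∈ τ(W) has degree at least f(x) in H[τ(W)].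
-- A vertex with f(τ(v)) = 0 gives W = {v}; otherwise W is V(G) for
-- M-configurations, a class {v : τ(v) ∈ U_i} with more than n_i elements for
-- K-configurations (such a class exists since the n_i add up to n − 1), and two
-- consecutive vertices for C-configurations, where parity forces the choices
-- at some two consecutive vertices to be adjacent in H.  When two configurations are
-- merged, either one of the two sets avoids the identified vertex and can be
-- kept, or their union works because both degree and f add up there.

module Submission where

open import Defs
open import Data.Product using (∃-syntax; _×_; _,_; proj₁; proj₂)
  renaming (swap to ×-swap)
open import Relation.Binary.PropositionalEquality
  using (_≡_; _≢_; refl; sym; trans; cong; cong₂; subst; module ≡-Reasoning)
import Algebra.Properties.CommutativeMonoid.Sum
import Algebra.Properties.Semiring.Sum
open import Data.Bool using (Bool; true; false; not; if_then_else_)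
open import Data.Bool.Properties using (not-involutive)
open import Data.Fin using (Fin; zero; suc; toℕ; fromℕ<; _↑ˡ_; _↑ʳ_; _≟_)
open import Data.Fin.Permutation using (↔⇒≡)
open import Data.Fin.Properties
  using (any?; toℕ<n; toℕ-fromℕ<; toℕ-injective; toℕ-↑ˡ; toℕ-↑ʳ)
open import Data.Fin.Subset
  using (Subset; _∈_; _∉_; _⊆_; _∩_; _∪_; ⁅_⁆; ∣_∣; Nonempty; Empty; ⊤)
open import Data.Fin.Subset.Properties
open import Data.Nat
  using (ℕ; zero; suc; _+_; _*_; _∸_; _≤_; _<_; _≥_; z≤n; s≤s; _<?_; NonZero; >-nonZero; ≢-nonZero⁻¹)
open import Data.Nat.Divisibility using (_∣_; _∤_; m%n≡0⇒n∣m; divides)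
open import Data.Nat.DivMod
open import Data.Nat.Properties renaming (_≟_ to _≟ℕ_)
open import Data.Sum using (_⊎_; inj₁; inj₂; [_,_]′; swap)
open import Data.Vec using (lookup; tabulate; []; _∷_)
open import Data.Vec.Properties using ([]=⇒lookup; lookup⇒[]=; lookup∘tabulate)
open import Data.Vec.Properties.WithK using ([]=-irrelevant)
open import Function using (_∘_; const)
open import Function.Bundles using (_↔_; mk⇔; module Inverse; module Equivalence; module Injection)
open import Function.Definitions using (Injective)
open import Function.Properties.Inverse using (↔⇒↣; ↔-sym)
open import Relation.Nullary using (¬_; Dec; yes; no; does; contradiction)
open import Relation.Nullary.Decidable using (_×-dec_; dec-true; dec-false)

open Algebra.Properties.CommutativeMonoid.Sum +-0-commutativeMonoid
  using (sum; sum-cong-≗; sum-replicate-zero; ∑-distrib-+; ∑-comm; sum-permute)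
open Algebra.Properties.Semiring.Sum +-*-semiring using (*-distribˡ-sum; *-distribʳ-sum)

-- Finite sums

sum-zero : ∀ {n} {f : Fin n → ℕ} → (∀ x → f x ≡ 0) → sum f ≡ 0
sum-zero {n} f≡0 = trans (sum-cong-≗ f≡0) (sum-replicate-zero n)

sum-single : ∀ {n} {f : Fin n → ℕ} a → (∀ x → x ≢ a → f x ≡ 0) → sum f ≡ f a
sum-single {suc n} {f} zero f≡0 =
  trans (cong (f zero +_) (sum-zero λ x → f≡0 (suc x) λ ())) (+-identityʳ _)
sum-single {suc n} {f} (suc a) f≡0 =
  cong₂ _+_ (f≡0 zero λ ()) (sum-single a λ { x x≢a → f≡0 (suc x) λ { refl → x≢a refl } })

sum-mono : ∀ {n} {f g : Fin n → ℕ} → (∀ x → f x ≤ g x) → sum f ≤ sum g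
sum-mono {zero}  f≤g = z≤n
sum-mono {suc n} f≤g = +-mono-≤ (f≤g zero) (sum-mono (f≤g ∘ suc))

restrict : ∀ {n} → Subset n → (Fin n → ℕ) → Fin n → ℕ
restrict S f x = if lookup S x then f x else 0

∈-lookup : ∀ {n} {S : Subset n} {x} → x ∈ S → lookup S x ≡ true
∈-lookup = []=⇒lookup

∉-lookup : ∀ {n} {S : Subset n} {x} → x ∉ S → lookup S x ≡ false
∉-lookup {S = S} {x} x∉S with lookup S x in eq
... | true  = contradiction (lookup⇒[]= x S eq) x∉S
... | false = refl

restrict-∈ : ∀ {n} {S : Subset n} {f x} → x ∈ S → restrict S f x ≡ f x
restrict-∈ x∈S rewrite ∈-lookup x∈S = refl

restrict-∉ : ∀ {n} {S : Subset n} {f x} → x ∉ S → restrict S f x ≡ 0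
restrict-∉ x∉S rewrite ∉-lookup x∉S = refl

module _ {n} {f g : Fin n → ℕ} where

  sumOver-cong : ∀ S → (∀ x → x ∈ S → f x ≡ g x) → sumOver S f ≡ sumOver S g
  sumOver-cong S f≡g = sum-cong-≗ pointwise
    where
    pointwise : ∀ x → restrict S f x ≡ restrict S g x
    pointwise x with x ∈? S
    ... | yes x∈S = trans (restrict-∈ {f = f} x∈S) (trans (f≡g x x∈S) (sym (restrict-∈ {f = g} x∈S)))
    ... | no  x∉S = trans (restrict-∉ {f = f} x∉S) (sym (restrict-∉ {f = g} x∉S))

  sumOver-distrib-+ : ∀ S → sumOver S (λ x → f x + g x) ≡ sumOver S f + sumOver S g
  sumOver-distrib-+ S = trans (sum-cong-≗ pointwise) (∑-distrib-+ (restrict S f) (restrict S g))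
    where
    pointwise : ∀ x → restrict S (λ x → f x + g x) x ≡ restrict S f x + restrict S g x
    pointwise x with lookup S x
    ... | true  = refl
    ... | false = refl

module _ {n} (f : Fin n → ℕ) where

  sumOver-⊤ : sumOver ⊤ f ≡ sum f
  sumOver-⊤ = sum-cong-≗ λ x → restrict-∈ {f = f} (∈⊤ {x = x})

  sumOver-⁅⁆ : ∀ a → sumOver ⁅ a ⁆ f ≡ f a
  sumOver-⁅⁆ a = trans
    (sum-single {f = restrict ⁅ a ⁆ f} a λ x x≢a → restrict-∉ {f = f} (x≢y⇒x∉⁅y⁆ x≢a))
    (restrict-∈ {f = f} (x∈⁅x⁆ a))

  sumOver-⊆ : ∀ {A B} → A ⊆ B → sumOver A f ≤ sumOver B f
  sumOver-⊆ {A} {B} A⊆B = sum-mono pointwise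
    where
    pointwise : ∀ x → restrict A f x ≤ restrict B f x
    pointwise x with x ∈? A
    ... | yes x∈A = ≤-reflexive (trans (restrict-∈ {f = f} x∈A) (sym (restrict-∈ {f = f} (A⊆B x∈A))))
    ... | no  x∉A = ≤-trans (≤-reflexive (restrict-∉ {f = f} x∉A)) z≤n

  sumOver-∈ : ∀ {S x} → x ∈ S → f x ≤ sumOver S f
  sumOver-∈ {S} {x} x∈S = subst (_≤ sumOver S f) (sumOver-⁅⁆ x)
    (sumOver-⊆ λ y∈ → subst (_∈ S) (sym (x∈⁅y⁆⇒x≡y x y∈)) x∈S)

  sumOver-shrink : ∀ {A B} → A ⊆ B → (∀ x → x ∈ B → x ∉ A → f x ≡ 0) → sumOver B f ≡ sumOver A f
  sumOver-shrink {A} {B} A⊆B f≡0 = sum-cong-≗ pointwise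
    where
    pointwise : ∀ x → restrict B f x ≡ restrict A f x
    pointwise x with x ∈? A | x ∈? B
    ... | yes x∈A | _       = trans (restrict-∈ {f = f} (A⊆B x∈A)) (sym (restrict-∈ {f = f} x∈A))
    ... | no  x∉A | yes x∈B = trans (restrict-∈ {f = f} x∈B) (trans (f≡0 x x∈B x∉A) (sym (restrict-∉ {f = f} x∉A)))
    ... | no  x∉A | no  x∉B = trans (restrict-∉ {f = f} x∉B) (sym (restrict-∉ {f = f} x∉A))

  sumOver-∪ : ∀ A B → (∀ x → x ∈ A → x ∈ B → f x ≡ 0) →
              sumOver (A ∪ B) f ≡ sumOver A f + sumOver B f
  sumOver-∪ A B f≡0 = trans (sum-cong-≗ pointwise) (∑-distrib-+ (restrict A f) (restrict B f))
    where
    pointwise : ∀ x → restrict (A ∪ B) f x ≡ restrict A f x + restrict B f x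
    pointwise x with x ∈? A | x ∈? B
    ... | yes x∈A | yes x∈B
      rewrite ∈-lookup (x∈p∪q⁺ {p = A} {q = B} (inj₁ x∈A)) | ∈-lookup x∈A | ∈-lookup x∈B
            | f≡0 x x∈A x∈B = refl
    ... | yes x∈A | no  x∉B
      rewrite ∈-lookup (x∈p∪q⁺ {p = A} {q = B} (inj₁ x∈A)) | ∈-lookup x∈A | ∉-lookup x∉B
            = sym (+-identityʳ _)
    ... | no  x∉A | yes x∈B
      rewrite ∈-lookup (x∈p∪q⁺ {p = A} {q = B} (inj₂ x∈B)) | ∉-lookup x∉A | ∈-lookup x∈B
            = refl
    ... | no  x∉A | no  x∉B
      rewrite ∉-lookup {S = A ∪ B} ([ x∉A , x∉B ]′ ∘ x∈p∪q⁻ A B) | ∉-lookup x∉A | ∉-lookup x∉B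
            = refl

  sumOver-distribʳ-* : ∀ S c → sumOver S f * c ≡ sumOver S (λ x → f x * c)
  sumOver-distribʳ-* S c = trans (*-distribʳ-sum c (restrict S f)) (sum-cong-≗ pointwise)
    where
    pointwise : ∀ x → restrict S f x * c ≡ restrict S (λ x → f x * c) x
    pointwise x with lookup S x
    ... | true  = refl
    ... | false = refl

sumOver-const : ∀ {n} (S : Subset n) c → sumOver S (const c) ≡ ∣ S ∣ * c
sumOver-const []          c = refl
sumOver-const (true  ∷ S) c = cong (c +_) (sumOver-const S c)
sumOver-const (false ∷ S) c = sumOver-const S c

∣S∣-as-sum : ∀ {n} (S : Subset n) → ∣ S ∣ ≡ sumOver S (const 1)
∣S∣-as-sum S = sym (trans (sumOver-const S 1) (*-identityʳ _))

nonempty⇒∣∣≥1 : ∀ {n} {S : Subset n} → Nonempty S → 1 ≤ ∣ S ∣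
nonempty⇒∣∣≥1 {S = S} (x , x∈S) = subst (1 ≤_) (sym (∣S∣-as-sum S)) (sumOver-∈ (const 1) x∈S)

sumOver-average : ∀ {n} {A : Subset n} {f : Fin n → ℕ} {c} → Nonempty A →
                  (∀ x → x ∈ A → f x * ∣ A ∣ ≡ c) → sumOver A f ≡ c
sumOver-average {A = A} {f} {c} A≢∅ avg =
  *-cancelʳ-≡ _ _ ∣ A ∣ ⦃ >-nonZero (nonempty⇒∣∣≥1 A≢∅) ⦄ (begin
    sumOver A f * ∣ A ∣           ≡⟨ sumOver-distribʳ-* f A ∣ A ∣ ⟩
    sumOver A (λ x → f x * ∣ A ∣) ≡⟨ sumOver-cong A avg ⟩
    sumOver A (const c)           ≡⟨ sumOver-const A c ⟩
    ∣ A ∣ * c                     ≡⟨ *-comm ∣ A ∣ c ⟩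
    c * ∣ A ∣                     ∎)
  where open ≡-Reasoning

-- Images of finite sets

comprehension : ∀ {n} {P : Fin n → Set} → (∀ x → Dec (P x)) → Subset n
comprehension P? = tabulate (does ∘ P?)

module _ {n} {P : Fin n → Set} (P? : ∀ x → Dec (P x)) where

  comprehension⁺ : ∀ {x} → P x → x ∈ comprehension P?
  comprehension⁺ {x} px = lookup⇒[]= x _ (trans (lookup∘tabulate _ x) (dec-true (P? x) px))

  comprehension⁻ : ∀ {x} → x ∈ comprehension P? → P x
  comprehension⁻ {x} x∈ with P? x | trans (sym (lookup∘tabulate (does ∘ P?) x)) ([]=⇒lookup x∈)
  ... | yes px | _  = px
  ... | no  _  | ()

module _ {m n} (j : Fin m → Fin n) (S : Subset m) where

  private
    inImage? : ∀ z → Dec (∃[ x ] (x ∈ S × j x ≡ z))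
    inImage? z = any? λ x → (x ∈? S) ×-dec (j x ≟ z)

  image : Subset n
  image = comprehension inImage?

  image⁺ : ∀ {x} → x ∈ S → j x ∈ image
  image⁺ x∈S = comprehension⁺ inImage? (_ , x∈S , refl)

  image⁻ : ∀ {z} → z ∈ image → ∃[ x ] (x ∈ S × j x ≡ z)
  image⁻ = comprehension⁻ inImage?

  sumOver-image : Injective _≡_ _≡_ j → ∀ g → sumOver image g ≡ sumOver S (g ∘ j)
  sumOver-image j-inj g = begin
    sum (restrict image g)   ≡⟨ sum-cong-≗ column ⟩
    sum (λ z → sum (entry z)) ≡⟨ ∑-comm entry ⟩
    sum (λ x → sum λ z → entry z x)
      ≡⟨ sum-cong-≗ (λ x → sumOver-⁅⁆ (const (restrict S (g ∘ j) x)) (j x)) ⟩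
    sum (restrict S (g ∘ j)) ∎
    where
    open ≡-Reasoning

    entry : Fin n → Fin m → ℕ
    entry z x = restrict ⁅ j x ⁆ (const (restrict S (g ∘ j) x)) z

    entry-≡ : ∀ x → entry (j x) x ≡ restrict S (g ∘ j) x
    entry-≡ x = restrict-∈ {f = const (restrict S (g ∘ j) x)} (x∈⁅x⁆ (j x))

    entry-≢ : ∀ {z} x → j x ≢ z → entry z x ≡ 0
    entry-≢ x jx≢z = restrict-∉ {f = const (restrict S (g ∘ j) x)} (x≢y⇒x∉⁅y⁆ (jx≢z ∘ sym))

    column : ∀ z → restrict image g z ≡ sum (entry z)
    column z with z ∈? image
    column z | yes z∈ with image⁻ z∈
    ... | a , a∈S , refl = begin
      restrict image g (j a)  ≡⟨ restrict-∈ {f = g} z∈ ⟩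
      g (j a)                 ≡⟨ restrict-∈ {S = S} {f = g ∘ j} a∈S ⟨
      restrict S (g ∘ j) a    ≡⟨ entry-≡ a ⟨
      entry (j a) a           ≡⟨ sum-single a (λ x x≢a → entry-≢ x (x≢a ∘ j-inj)) ⟨
      sum (entry (j a))       ∎
    column z | no z∉ = trans (restrict-∉ {f = g} z∉) (sym (sum-zero vanish))
      where
      vanish : ∀ x → entry z x ≡ 0
      vanish x with j x ≟ z
      ... | no jx≢z = entry-≢ x jx≢z
      ... | yes refl = trans (entry-≡ x) (restrict-∉ {f = g ∘ j} (z∉ ∘ image⁺))

  ∣image∣ : Injective _≡_ _≡_ j → ∣ image ∣ ≡ ∣ S ∣
  ∣image∣ j-inj = trans (∣S∣-as-sum image)
    (trans (sumOver-image j-inj (const 1)) (sym (∣S∣-as-sum S)))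

-- Obstructions

Selector : (C : Configuration) → (V (G C) → V (Hᶜ C)) → Set
Selector C τ = ∀ v → τ v ∈ Xᶜ C v

Obstruction : (C : Configuration) → (V (G C) → V (Hᶜ C)) → Set
Obstruction C τ = ∃[ W ] (Nonempty W ×
  (∀ v → v ∈ W → f C (τ v) ≤ sumOver W (λ u → μ (Hᶜ C) (τ v) (τ u))))

Obstructed : Configuration → Set
Obstructed C = ∀ τ → Selector C τ → Obstruction C τ

fibre-unique : ∀ {G} (C : Cover G) {u v x} → x ∈ X C u → x ∈ X C v → u ≡ v
fibre-unique C = Cover.disjoint C _ _ _

selector-injective : ∀ {C τ} → Selector C τ → Injective _≡_ _≡_ τ
selector-injective {C} τ∈ {u} {v} τu≡τv =
  fibre-unique (cover C) (τ∈ u) (subst (_∈ Xᶜ C v) (sym τu≡τv) (τ∈ v))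

∣∣≡1⇒nonempty : ∀ {n} {S : Subset n} → ∣ S ∣ ≡ 1 → Nonempty S
∣∣≡1⇒nonempty {n} {S} ∣S∣≡1 with nonempty? S
... | yes S≢∅ = S≢∅
... | no  S≡∅ with trans (sym ∣S∣≡1) (trans (cong ∣_∣ (Empty-unique S≡∅)) (∣⊥∣≡0 n))
... | ()

obstructed⇒uncolorable : ∀ {C} → Obstructed C → Uncolorable C
obstructed⇒uncolorable {C} obs (S , transversal , degenerate) = <-irrefl refl (begin-strict
  sumOver T (μ (Hᶜ C) x)                     ≡⟨ subdegree-T ⟨
  subdegree (induced (Hᶜ C) T) x             <⟨ deg<f ⟩
  f C x                                      ≡⟨ cong (f C) τv≡x ⟨
  f C (τ v)                                  ≤⟨ blocked v v∈W ⟩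
  sumOver W (λ u → μ (Hᶜ C) (τ v) (τ u))     ≡⟨ sumOver-image τ W τ-injective _ ⟨
  sumOver T (μ (Hᶜ C) (τ v))                 ≡⟨ cong (λ z → sumOver T (μ (Hᶜ C) z)) τv≡x ⟩
  sumOver T (μ (Hᶜ C) x)                     ∎)
  where
  open ≤-Reasoning

  chosen : ∀ v → Nonempty (S ∩ Xᶜ C v)
  chosen v = ∣∣≡1⇒nonempty (transversal v)

  τ : V (G C) → V (Hᶜ C)
  τ = proj₁ ∘ chosen

  τ-split : ∀ v → τ v ∈ S × τ v ∈ Xᶜ C v
  τ-split v = x∈p∩q⁻ S (Xᶜ C v) (proj₂ (chosen v))

  τ-injective : Injective _≡_ _≡_ τ
  τ-injective = selector-injective {C} (proj₂ ∘ τ-split)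

  obstruction = obs τ (proj₂ ∘ τ-split)
  W = proj₁ obstruction
  blocked = proj₂ (proj₂ obstruction)

  T : VSet (Hᶜ C)
  T = image τ W

  T⊆S : T ⊆ S
  T⊆S x∈T with image⁻ τ W x∈T
  ... | v , _ , refl = proj₁ (τ-split v)

  mult≤ : ∀ x y → mult (induced (Hᶜ C) T) x y ≤ mult (induced (Hᶜ C) S) x y
  mult≤ x y with x ∈? T | y ∈? T
  ... | yes x∈T | yes y∈T
    rewrite ∈-lookup x∈T | ∈-lookup y∈T | ∈-lookup (T⊆S x∈T) | ∈-lookup (T⊆S y∈T) = ≤-refl
  ... | yes x∈T | no y∉T rewrite ∈-lookup x∈T | ∉-lookup y∉T = z≤n
  ... | no x∉T  | _      rewrite ∉-lookup x∉T = z≤n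

  T≢∅ : Nonempty T
  T≢∅ with proj₁ (proj₂ obstruction)
  ... | v , v∈W = τ v , image⁺ τ W v∈W

  peeled = degenerate (induced (Hᶜ C) T) (T⊆S , mult≤) T≢∅
  x = proj₁ peeled
  x∈T = proj₁ (proj₂ peeled)
  deg<f = proj₂ (proj₂ peeled)
  v = proj₁ (image⁻ τ W x∈T)
  v∈W = proj₁ (proj₂ (image⁻ τ W x∈T))
  τv≡x = proj₂ (proj₂ (image⁻ τ W x∈T))

  subdegree-T : subdegree (induced (Hᶜ C) T) x ≡ sumOver T (μ (Hᶜ C) x)
  subdegree-T rewrite ∈-lookup x∈T = refl

single-obstruction : ∀ {C τ} v → f C (τ v) ≡ 0 → Obstruction C τ
single-obstruction {C} {τ} v fv≡0 = ⁅ v ⁆ , (v , x∈⁅x⁆ v) , λ u u∈ →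
  ≤-trans (≤-reflexive (trans (cong (f C ∘ τ) (x∈⁅y⁆⇒x≡y v u∈)) fv≡0)) z≤n

pair-obstruction : ∀ {C τ} u v → f C (τ u) ≤ μ (Hᶜ C) (τ u) (τ v) →
                   f C (τ v) ≤ μ (Hᶜ C) (τ u) (τ v) → Obstruction C τ
pair-obstruction {C} {τ} u v fu≤ fv≤ = W , (u , u∈W) , blocked
  where
  W = ⁅ u ⁆ ∪ ⁅ v ⁆
  u∈W : u ∈ W
  u∈W = x∈p∪q⁺ (inj₁ (x∈⁅x⁆ u))
  v∈W : v ∈ W
  v∈W = x∈p∪q⁺ (inj₂ (x∈⁅x⁆ v))

  blocked : ∀ w → w ∈ W → f C (τ w) ≤ sumOver W (λ w′ → μ (Hᶜ C) (τ w) (τ w′))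
  blocked w w∈ with x∈p∪q⁻ ⁅ u ⁆ ⁅ v ⁆ w∈
  ... | inj₁ w∈u rewrite x∈⁅y⁆⇒x≡y {x = w} u w∈u = ≤-trans fu≤ (sumOver-∈ (μ (Hᶜ C) (τ u) ∘ τ) v∈W)
  ... | inj₂ w∈v rewrite x∈⁅y⁆⇒x≡y v w∈v =
    ≤-trans (≤-trans fv≤ (≤-reflexive (μ-sym (Hᶜ C) (τ u) (τ v)))) (sumOver-∈ (μ (Hᶜ C) (τ v) ∘ τ) u∈W)

obstructed-if-positive : ∀ {C τ} → ((∀ v → f C (τ v) ≢ 0) → Obstruction C τ) → Obstruction C τ
obstructed-if-positive {C} {τ} obs with any? (λ v → f C (τ v) ≟ℕ 0)
... | yes (v , fv≡0) = single-obstruction {C} v fv≡0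
... | no  positive   = obs λ v fv≡0 → positive (v , fv≡0)

-- Merging two configurations

swapMerge : ∀ {C₁ C₂ C} → IsMerge C₁ C₂ C → IsMerge C₂ C₁ C
swapMerge {C₁} {C₂} {C} M = record
  { v₁ = v₂ ; v₂ = v₁
  ; i₁ = i₂ ; i₂ = i₁
  ; i₁-injective = i₂-injective ; i₂-injective = i₁-injective
  ; i-exhaustive = swap ∘ i-exhaustive
  ; i-identified = λ u w → mk⇔
      (×-swap ∘ Equivalence.to (i-identified w u) ∘ sym)
      (sym ∘ Equivalence.from (i-identified w u) ∘ ×-swap)
  ; μG₁ = μG₂ ; μG₂ = μG₁
  ; μG₁₂ = λ u w u≢ w≢ → trans (μ-sym (G C) (i₂ u) (i₁ w)) (μG₁₂ w u w≢ u≢)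
  ; π = ↔-sym π
  ; j₁ = j₂ ; j₂ = j₁
  ; j₁-injective = j₂-injective ; j₂-injective = j₁-injective
  ; j-exhaustive = swap ∘ j-exhaustive
  ; j-identified = λ y x → mk⇔ (to-swapped y x) (from-swapped y x)
  ; μH₁ = μH₂ ; μH₂ = μH₁
  ; μH₁₂ = λ y x y∉ x∉ → trans (μ-sym (Hᶜ C) (j₂ y) (j₁ x)) (μH₁₂ x y x∉ y∉)
  ; X₁ = X₂ ; X₂ = X₁
  ; f₁ = f₂ ; f₂ = f₁
  ; f* = λ y y∈ → let x , x∈ = Inverse.from π (y , y∈) in
      begin
        f C (j₂ y)                                    ≡⟨ cong (f C) (from-swapped y x (y∈ , refl)) ⟩
        f C (j₁ x)                                    ≡⟨ f* x x∈ ⟩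
        f C₁ x + f C₂ (proj₁ (Inverse.to π (x , x∈)))
          ≡⟨ cong (λ z → f C₁ x + f C₂ (proj₁ z)) (Inverse.strictlyInverseˡ π (y , y∈)) ⟩
        f C₁ x + f C₂ y                               ≡⟨ +-comm (f C₁ x) (f C₂ y) ⟩
        f C₂ y + f C₁ x                               ∎
  }
  where
  open IsMerge M
  open ≡-Reasoning

  to-swapped : ∀ y x → j₂ y ≡ j₁ x →
               ∃[ y∈ ] (proj₁ (Inverse.from π (y , y∈)) ≡ x)
  to-swapped y x eq with Equivalence.to (j-identified x y) (sym eq)
  ... | x∈ , refl = proj₂ (Inverse.to π (x , x∈)) , cong proj₁ (Inverse.strictlyInverseʳ π (x , x∈))

  from-swapped : ∀ y x → ∃[ y∈ ] (proj₁ (Inverse.from π (y , y∈)) ≡ x) → j₂ y ≡ j₁ x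
  from-swapped y x (y∈ , refl) = sym (Equivalence.from (j-identified x y)
    (proj₂ (Inverse.from π (y , y∈)) , cong proj₁ (Inverse.strictlyInverseˡ π (y , y∈))))

extend : ∀ {m n} → (Fin m → Fin n) → (Fin m → ℕ) → Fin n → ℕ
extend j h z = sum λ x → if does (j x ≟ z) then h x else 0

extend-image : ∀ {m n} {j : Fin m → Fin n} {h} → Injective _≡_ _≡_ j → ∀ x → extend j h (j x) ≡ h x
extend-image {j = j} {h} j-inj x = trans (sum-single x off-diagonal) on-diagonal
  where
  off-diagonal : ∀ y → y ≢ x → (if does (j y ≟ j x) then h y else 0) ≡ 0
  off-diagonal y y≢x rewrite dec-false (j y ≟ j x) (y≢x ∘ j-inj) = refl
  on-diagonal : (if does (j x ≟ j x) then h x else 0) ≡ h x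
  on-diagonal rewrite dec-true (j x ≟ j x) refl = refl

Balanced : Configuration → Set
Balanced C = ∀ v → sumOver (Xᶜ C v) (f C) ≡ degree (G C) v

module Merge {C₁ C₂ C} (M : IsMerge C₁ C₂ C) where
  open IsMerge M

  i-glued : i₁ v₁ ≡ i₂ v₂
  i-glued = Equivalence.from (i-identified v₁ v₂) (refl , refl)

  i-overlap : ∀ {u w} → i₁ u ≡ i₂ w → u ≡ v₁ × w ≡ v₂
  i-overlap = Equivalence.to (i-identified _ _)

  j-glued : ∀ {y} → y ∈ Xᶜ C₂ v₂ → ∃[ x ] (x ∈ Xᶜ C₁ v₁ × j₁ x ≡ j₂ y)
  j-glued {y} y∈ =
    let x , x∈ = Inverse.from π (y , y∈) in
    x , x∈ , Equivalence.from (j-identified x y)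
               (x∈ , cong proj₁ (Inverse.strictlyInverseˡ π (y , y∈)))

  f-glued : ∀ {x y} → j₁ x ≡ j₂ y → f C (j₁ x) ≡ f C₁ x + f C₂ y
  f-glued {x} {y} eq with Equivalence.to (j-identified x y) eq
  ... | x∈ , refl = f* x x∈

  fibre⁻ : ∀ {v z} → z ∈ Xᶜ C (i₁ v) → ∃[ x ] (x ∈ Xᶜ C₁ v × j₁ x ≡ z)
  fibre⁻ {v} {z} z∈ with j-exhaustive z
  ... | inj₁ (x , refl) = x , Equivalence.to (X₁ v x) z∈ , refl
  ... | inj₂ (y , refl) with Cover.exhaustive (cover C₂) y
  ... | w , y∈ with i-overlap (fibre-unique (cover C) z∈ (Equivalence.from (X₂ w y) y∈))
  ... | refl , refl = j-glued y∈

  fibre-image : ∀ v → Xᶜ C (i₁ v) ≡ image j₁ (Xᶜ C₁ v)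
  fibre-image v = ⊆-antisym ⊆-image image-⊆
    where
    ⊆-image : Xᶜ C (i₁ v) ⊆ image j₁ (Xᶜ C₁ v)
    ⊆-image z∈ with fibre⁻ z∈
    ... | x , x∈ , refl = image⁺ j₁ (Xᶜ C₁ v) x∈
    image-⊆ : image j₁ (Xᶜ C₁ v) ⊆ Xᶜ C (i₁ v)
    image-⊆ z∈ with image⁻ j₁ (Xᶜ C₁ v) z∈
    ... | x , x∈ , refl = Equivalence.from (X₁ v x) x∈

  sumOver-fibre : ∀ v g → sumOver (Xᶜ C (i₁ v)) g ≡ sumOver (Xᶜ C₁ v) (g ∘ j₁)
  sumOver-fibre v g = trans (cong (λ S → sumOver S g) (fibre-image v))
                            (sumOver-image j₁ (Xᶜ C₁ v) j₁-injective g)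

  sum-image : ∀ u → sumOver (image i₁ ⊤) (μ (G C) (i₁ u)) ≡ degree (G C₁) u
  sum-image u = trans (sumOver-image i₁ ⊤ i₁-injective (μ (G C) (i₁ u)))
    (trans (sumOver-⊤ (μ (G C) (i₁ u) ∘ i₁)) (sum-cong-≗ (μG₁ u)))

  degree-merge-≢ : ∀ {u} → u ≢ v₁ → degree (G C) (i₁ u) ≡ degree (G C₁) u
  degree-merge-≢ {u} u≢v₁ = trans (sym (sumOver-⊤ (μ (G C) (i₁ u))))
    (trans (sumOver-shrink (μ (G C) (i₁ u)) {A = image i₁ ⊤} ⊆⊤ vanish) (sum-image u))
    where
    vanish : ∀ w → w ∈ ⊤ → w ∉ image i₁ ⊤ → μ (G C) (i₁ u) w ≡ 0
    vanish w _ w∉ with i-exhaustive w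
    ... | inj₁ (w′ , refl) = contradiction (image⁺ i₁ ⊤ ∈⊤) w∉
    ... | inj₂ (w′ , refl) = μG₁₂ u w′ u≢v₁ λ { refl →
      w∉ (subst (_∈ image i₁ ⊤) i-glued (image⁺ i₁ ⊤ ∈⊤)) }

  fibreSum-≢ : ∀ {u} → u ≢ v₁ → sumOver (Xᶜ C (i₁ u)) (f C) ≡ sumOver (Xᶜ C₁ u) (f C₁)
  fibreSum-≢ {u} u≢v₁ = trans (sumOver-fibre u (f C))
    (sumOver-cong (Xᶜ C₁ u) λ x x∈ → f₁ x λ x∈′ → u≢v₁ (fibre-unique (cover C₁) x∈ x∈′))

  module _ {τ} (τ∈ : Selector C τ) where

    part : V (G C₁) → V (Hᶜ C₁)
    part u = proj₁ (fibre⁻ (τ∈ (i₁ u)))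

    part-selector : Selector C₁ part
    part-selector u = proj₁ (proj₂ (fibre⁻ (τ∈ (i₁ u))))

    j₁-part : ∀ u → j₁ (part u) ≡ τ (i₁ u)
    j₁-part u = proj₂ (proj₂ (fibre⁻ (τ∈ (i₁ u))))

    part-degree : ∀ W u → sumOver (image i₁ W) (μ (Hᶜ C) (τ (i₁ u)) ∘ τ)
                        ≡ sumOver W (μ (Hᶜ C₁) (part u) ∘ part)
    part-degree W u = trans (sumOver-image i₁ W i₁-injective _) (sumOver-cong W λ w _ →
      trans (cong₂ (μ (Hᶜ C)) (sym (j₁-part u)) (sym (j₁-part w))) (μH₁ (part u) (part w)))

    f-part : ∀ {u} → u ≢ v₁ → f C (τ (i₁ u)) ≡ f C₁ (part u)
    f-part {u} u≢v₁ = trans (cong (f C) (sym (j₁-part u)))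
      (f₁ (part u) λ x∈ → u≢v₁ (fibre-unique (cover C₁) (part-selector u) x∈))

    blocked-≢ : ∀ {W u} → f C₁ (part u) ≤ sumOver W (μ (Hᶜ C₁) (part u) ∘ part) → u ≢ v₁ →
                f C (τ (i₁ u)) ≤ sumOver (image i₁ W) (μ (Hᶜ C) (τ (i₁ u)) ∘ τ)
    blocked-≢ {W} {u} blocked u≢v₁ = begin
      f C (τ (i₁ u))                                      ≡⟨ f-part u≢v₁ ⟩
      f C₁ (part u)                                       ≤⟨ blocked ⟩
      sumOver W (μ (Hᶜ C₁) (part u) ∘ part)               ≡⟨ part-degree W u ⟨
      sumOver (image i₁ W) (μ (Hᶜ C) (τ (i₁ u)) ∘ τ)      ∎
      where open ≤-Reasoning

    obstruction-avoiding : ((W , _) : Obstruction C₁ part) → v₁ ∉ W → Obstruction C τ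
    obstruction-avoiding (W , (u , u∈W) , blocked) v₁∉W =
      image i₁ W , (i₁ u , image⁺ i₁ W u∈W) , blocked′
      where
      blocked′ : ∀ v → v ∈ image i₁ W → f C (τ v) ≤ sumOver (image i₁ W) (μ (Hᶜ C) (τ v) ∘ τ)
      blocked′ v v∈ with image⁻ i₁ W v∈
      ... | w , w∈W , refl = blocked-≢ (blocked w w∈W) λ { refl → v₁∉W w∈W }

module _ {C₁ C₂ C} (M : IsMerge C₁ C₂ C) where
  open IsMerge M
  private
    module L = Merge M
    module R = Merge (swapMerge M)

  degree-merge : degree (G C) (i₁ v₁) ≡ degree (G C₁) v₁ + degree (G C₂) v₂
  degree-merge = begin
    sum d                                           ≡⟨ sumOver-⊤ d ⟨
    sumOver ⊤ d                                     ≡⟨ sumOver-shrink d ⊆⊤ vanish ⟩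
    sumOver (A ∪ B) d                               ≡⟨ sumOver-∪ d A B overlap≡0 ⟩
    sumOver A d + sumOver B d                       ≡⟨ cong (sumOver A d +_) (cong (λ v → sumOver B (μ (G C) v)) L.i-glued) ⟩
    sumOver A d + sumOver B (μ (G C) (i₂ v₂))       ≡⟨ cong₂ _+_ (L.sum-image v₁) (R.sum-image v₂) ⟩
    degree (G C₁) v₁ + degree (G C₂) v₂             ∎
    where
    open ≡-Reasoning
    d = μ (G C) (i₁ v₁)
    A = image i₁ ⊤
    B = image i₂ ⊤

    vanish : ∀ w → w ∈ ⊤ → w ∉ A ∪ B → d w ≡ 0
    vanish w _ w∉ with i-exhaustive w
    ... | inj₁ (_ , refl) = contradiction (x∈p∪q⁺ (inj₁ (image⁺ i₁ ⊤ ∈⊤))) w∉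
    ... | inj₂ (_ , refl) = contradiction (x∈p∪q⁺ (inj₂ (image⁺ i₂ ⊤ ∈⊤))) w∉

    overlap≡0 : ∀ w → w ∈ A → w ∈ B → d w ≡ 0
    overlap≡0 w w∈A w∈B with image⁻ i₁ ⊤ w∈A | image⁻ i₂ ⊤ w∈B
    ... | u , _ , refl | _ , _ , eq with L.i-overlap (sym eq)
    ... | refl , _ = loopless (G C) (i₁ v₁)

  fibreSum-merge : sumOver (Xᶜ C (i₁ v₁)) (f C)
                 ≡ sumOver (Xᶜ C₁ v₁) (f C₁) + sumOver (Xᶜ C₂ v₂) (f C₂)
  fibreSum-merge = begin
    sumOver Z (f C)                 ≡⟨ sumOver-cong Z split ⟩
    sumOver Z (λ z → F₁ z + F₂ z)   ≡⟨ sumOver-distrib-+ Z ⟩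
    sumOver Z F₁ + sumOver Z F₂     ≡⟨ cong₂ _+_ Σ₁ Σ₂ ⟩
    sumOver (Xᶜ C₁ v₁) (f C₁) + sumOver (Xᶜ C₂ v₂) (f C₂) ∎
    where
    open ≡-Reasoning
    Z = Xᶜ C (i₁ v₁)
    F₁ F₂ : V (Hᶜ C) → ℕ
    F₁ = extend j₁ (f C₁)
    F₂ = extend j₂ (f C₂)

    split : ∀ z → z ∈ Z → f C z ≡ F₁ z + F₂ z
    split z z∈ with L.fibre⁻ z∈
    ... | x , x∈ , refl with R.j-glued x∈
    ... | y , y∈ , eq = trans (L.f-glued (sym eq)) (sym (cong₂ _+_
      (extend-image j₁-injective x)
      (trans (cong F₂ (sym eq)) (extend-image j₂-injective y))))

    Σ₁ : sumOver Z F₁ ≡ sumOver (Xᶜ C₁ v₁) (f C₁)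
    Σ₁ = trans (L.sumOver-fibre v₁ F₁) (sumOver-cong (Xᶜ C₁ v₁) λ x _ → extend-image j₁-injective x)

    Σ₂ : sumOver Z F₂ ≡ sumOver (Xᶜ C₂ v₂) (f C₂)
    Σ₂ = trans (cong (λ v → sumOver (Xᶜ C v) F₂) L.i-glued)
      (trans (R.sumOver-fibre v₂ F₂) (sumOver-cong (Xᶜ C₂ v₂) λ y _ → extend-image j₂-injective y))

  obstruction-merge : ∀ {τ} (τ∈ : Selector C τ) →
                      Obstruction C₁ (L.part τ∈) → Obstruction C₂ (R.part τ∈) → Obstruction C τ
  obstruction-merge {τ} τ∈ O₁@(W₁ , _ , blocked₁) O₂@(W₂ , _ , blocked₂) with v₁ ∈? W₁ | v₂ ∈? W₂
  ... | no v₁∉ | _      = L.obstruction-avoiding τ∈ O₁ v₁∉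
  ... | yes _  | no v₂∉ = R.obstruction-avoiding τ∈ O₂ v₂∉
  ... | yes v₁∈ | yes v₂∈ = A ∪ B , (i₁ v₁ , x∈p∪q⁺ (inj₁ (image⁺ i₁ W₁ v₁∈))) , blocked
    where
    open ≤-Reasoning
    A = image i₁ W₁
    B = image i₂ W₂

    d : V (G C) → V (G C) → ℕ
    d v = μ (Hᶜ C) (τ v) ∘ τ

    overlap≡0 : ∀ w → w ∈ A → w ∈ B → d (i₁ v₁) w ≡ 0
    overlap≡0 w w∈A w∈B with image⁻ i₁ W₁ w∈A | image⁻ i₂ W₂ w∈B
    ... | u , _ , refl | _ , _ , eq with L.i-overlap (sym eq)
    ... | refl , _ = loopless (Hᶜ C) (τ (i₁ v₁))

    τ-glued : j₁ (L.part τ∈ v₁) ≡ j₂ (R.part τ∈ v₂)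
    τ-glued = trans (L.j₁-part τ∈ v₁) (trans (cong τ L.i-glued) (sym (R.j₁-part τ∈ v₂)))

    blocked* : f C (τ (i₁ v₁)) ≤ sumOver (A ∪ B) (d (i₁ v₁))
    blocked* = begin
      f C (τ (i₁ v₁))                                       ≡⟨ cong (f C) (L.j₁-part τ∈ v₁) ⟨
      f C (j₁ (L.part τ∈ v₁))                               ≡⟨ L.f-glued τ-glued ⟩
      f C₁ (L.part τ∈ v₁) + f C₂ (R.part τ∈ v₂)             ≤⟨ +-mono-≤ (blocked₁ v₁ v₁∈) (blocked₂ v₂ v₂∈) ⟩
      sumOver W₁ (μ (Hᶜ C₁) (L.part τ∈ v₁) ∘ L.part τ∈) + sumOver W₂ (μ (Hᶜ C₂) (R.part τ∈ v₂) ∘ R.part τ∈)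
        ≡⟨ cong₂ _+_ (L.part-degree τ∈ W₁ v₁) (R.part-degree τ∈ W₂ v₂) ⟨
      sumOver A (d (i₁ v₁)) + sumOver B (d (i₂ v₂))         ≡⟨ cong (λ v → sumOver A (d (i₁ v₁)) + sumOver B (d v)) L.i-glued ⟨
      sumOver A (d (i₁ v₁)) + sumOver B (d (i₁ v₁))         ≡⟨ sumOver-∪ (d (i₁ v₁)) A B overlap≡0 ⟨
      sumOver (A ∪ B) (d (i₁ v₁))                           ∎

    blocked : ∀ v → v ∈ A ∪ B → f C (τ v) ≤ sumOver (A ∪ B) (d v)
    blocked v v∈ with v ≟ i₁ v₁
    ... | yes refl = blocked*
    ... | no v≢ with x∈p∪q⁻ A B v∈
    ... | inj₁ v∈A with image⁻ i₁ W₁ v∈A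
    ...   | u , u∈W₁ , refl = ≤-trans
      (L.blocked-≢ τ∈ {W₁} (blocked₁ u u∈W₁) λ { refl → v≢ refl }) (sumOver-⊆ (d (i₁ u)) {A} (p⊆p∪q B))
    blocked v v∈ | no v≢ | inj₂ v∈B with image⁻ i₂ W₂ v∈B
    ...   | u , u∈W₂ , refl = ≤-trans
      (R.blocked-≢ τ∈ {W₂} (blocked₂ u u∈W₂) λ { refl → v≢ (sym L.i-glued) }) (sumOver-⊆ (d (i₂ u)) {B} (q⊆p∪q A B))

  merge-obstructed : Obstructed C₁ → Obstructed C₂ → Obstructed C
  merge-obstructed obs₁ obs₂ τ τ∈ = obstruction-merge τ∈
    (obs₁ (L.part τ∈) (L.part-selector τ∈)) (obs₂ (R.part τ∈) (R.part-selector τ∈))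

  merge-balanced : Balanced C₁ → Balanced C₂ → Balanced C
  merge-balanced bal₁ bal₂ v with v ≟ i₁ v₁
  ... | yes refl = trans fibreSum-merge (trans (cong₂ _+_ (bal₁ v₁) (bal₂ v₂)) (sym degree-merge))
  ... | no v≢ with i-exhaustive v
  ... | inj₁ (u , refl) = trans (L.fibreSum-≢ u≢v₁) (trans (bal₁ u) (sym (L.degree-merge-≢ u≢v₁)))
    where
    u≢v₁ : u ≢ v₁
    u≢v₁ refl = v≢ refl
  ... | inj₂ (u , refl) = trans (R.fibreSum-≢ u≢v₂) (trans (bal₂ u) (sym (R.degree-merge-≢ u≢v₂)))
    where
    u≢v₂ : u ≢ v₂
    u≢v₂ refl = v≢ (sym L.i-glued)

-- Inflations

∈-unique : ∀ {n} {U : Subset n} {p q : ∃[ x ] (x ∈ U)} → proj₁ p ≡ proj₁ q → p ≡ q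
∈-unique refl = cong (_ ,_) ([]=-irrelevant _ _)

↔-injective : ∀ {A B : Set} (i : A ↔ B) → Injective _≡_ _≡_ (Inverse.to i)
↔-injective i = Injection.injective (↔⇒↣ i)

fibre-nonempty : ∀ {G P} {C : Cover G} {U} → RestrictsToInflation P C U → ∀ v → Nonempty (X C v ∩ U)
fibre-nonempty (_ , restriction , _) = IsRestriction.full restriction

module Inflated {G P} {C : Cover G} {U} (R : RestrictsToInflation P C U) where

  private
    restriction = proj₁ (proj₂ R)
    inflation = proj₂ (proj₂ R)

  s : ℕ
  s = proj₁ inflation

  C₀ : Cover G
  C₀ = proj₁ (proj₂ inflation)

  private
    module D = IsRestriction restriction
    module I = IsInflationBy (proj₂ (proj₂ (proj₂ inflation)))

  s≥1 : 1 ≤ s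
  s≥1 = I.s≥1

  copy : V (H C₀) → Fin s → V (H C)
  copy a k = D.ι (I.vertex (a , k))

  copy-injective : ∀ {a b k l} → copy a k ≡ copy b l → (a , k) ≡ (b , l)
  copy-injective eq = ↔-injective I.bijection (↔-injective D.bijection (∈-unique eq))

  copy-injectiveʳ : ∀ a → Injective _≡_ _≡_ (copy a)
  copy-injectiveʳ a eq with copy-injective eq
  ... | refl = refl

  copy∈U : ∀ a k → copy a k ∈ U
  copy∈U a k = proj₂ (Inverse.to D.bijection (I.vertex (a , k)))

  copy-surjective : ∀ {x} → x ∈ U → ∃[ a ] ∃[ k ] copy a k ≡ x
  copy-surjective {x} x∈U = _ , _ , trans
    (cong D.ι (Inverse.strictlyInverseˡ I.bijection (Inverse.from D.bijection (x , x∈U))))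
    (cong proj₁ (Inverse.strictlyInverseˡ D.bijection (x , x∈U)))

  copy-fibre⁺ : ∀ {v a k} → a ∈ X C₀ v → copy a k ∈ X C v
  copy-fibre⁺ = Equivalence.to (D.fibres _ _) ∘ Equivalence.from (I.fibres _ _ _)

  copy-fibre⁻ : ∀ {v a k} → copy a k ∈ X C v → a ∈ X C₀ v
  copy-fibre⁻ = Equivalence.to (I.fibres _ _ _) ∘ Equivalence.from (D.fibres _ _)

  μ-copy : ∀ a b k l → μ (H C) (copy a k) (copy b l) * s ≡ μ (H C₀) a b
  μ-copy a b k l = trans (cong (_* s) (sym (D.μ-induced _ _))) (I.μ-inflated a b k l)

  copies : V (H C₀) → VSet (H C)
  copies a = image (copy a) ⊤

  ∣copies∣ : ∀ a → ∣ copies a ∣ ≡ s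
  ∣copies∣ a = trans (∣image∣ (copy a) ⊤ (copy-injectiveʳ a)) (∣⊤∣≡n s)

  ∣fibre∣-single : ∀ {v a} → X C₀ v ≡ ⁅ a ⁆ → ∣ X C v ∩ U ∣ ≡ s
  ∣fibre∣-single {v} {a} X₀v≡a = trans (cong ∣_∣ (⊆-antisym forth back)) (∣copies∣ a)
    where
    forth : X C v ∩ U ⊆ copies a
    forth z∈ with x∈p∩q⁻ (X C v) U z∈
    ... | z∈X , z∈U with copy-surjective z∈U
    ... | b , k , refl with x∈⁅y⁆⇒x≡y a (subst (b ∈_) X₀v≡a (copy-fibre⁻ z∈X))
    ... | refl = image⁺ (copy a) ⊤ ∈⊤

    back : copies a ⊆ X C v ∩ U
    back z∈ with image⁻ (copy a) ⊤ z∈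
    ... | k , _ , refl =
      x∈p∩q⁺ (copy-fibre⁺ (subst (a ∈_) (sym X₀v≡a) (x∈⁅x⁆ a)) , copy∈U a k)

  ∣fibre∣-pair : ∀ {v a b} → a ≢ b → X C₀ v ≡ ⁅ a ⁆ ∪ ⁅ b ⁆ → ∣ X C v ∩ U ∣ ≡ s + s
  ∣fibre∣-pair {v} {a} {b} a≢b X₀v≡ = begin
    ∣ X C v ∩ U ∣                   ≡⟨ cong ∣_∣ (⊆-antisym forth back) ⟩
    ∣ A ∪ B ∣                       ≡⟨ ∣S∣-as-sum (A ∪ B) ⟩
    sumOver (A ∪ B) one             ≡⟨ sumOver-∪ one A B (λ z z∈A z∈B → contradiction z∈B (disjoint z∈A)) ⟩
    sumOver A one + sumOver B one   ≡⟨ cong₂ _+_ (∣S∣-as-sum A) (∣S∣-as-sum B) ⟨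
    ∣ A ∣ + ∣ B ∣                   ≡⟨ cong₂ _+_ (∣copies∣ a) (∣copies∣ b) ⟩
    s + s                           ∎
    where
    open ≡-Reasoning
    A = copies a
    B = copies b
    one : V (H C) → ℕ
    one = const 1

    disjoint : ∀ {z} → z ∈ A → z ∉ B
    disjoint z∈A z∈B with image⁻ (copy a) ⊤ z∈A | image⁻ (copy b) ⊤ z∈B
    ... | k , _ , refl | l , _ , eq with copy-injective eq
    ... | refl = a≢b refl

    forth : X C v ∩ U ⊆ A ∪ B
    forth z∈ with x∈p∩q⁻ (X C v) U z∈
    ... | z∈X , z∈U with copy-surjective z∈U
    ... | c , k , refl with x∈p∪q⁻ ⁅ a ⁆ ⁅ b ⁆ (subst (c ∈_) X₀v≡ (copy-fibre⁻ z∈X))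
    ... | inj₁ c∈ with x∈⁅y⁆⇒x≡y a c∈
    ...   | refl = x∈p∪q⁺ (inj₁ (image⁺ (copy a) ⊤ ∈⊤))
    forth z∈ | z∈X , z∈U | c , k , refl | inj₂ c∈ with x∈⁅y⁆⇒x≡y b c∈
    ...   | refl = x∈p∪q⁺ (inj₂ (image⁺ (copy b) ⊤ ∈⊤))

    copies⊆ : ∀ {c} → c ∈ ⁅ a ⁆ ∪ ⁅ b ⁆ → copies c ⊆ X C v ∩ U
    copies⊆ {c} c∈ z∈ with image⁻ (copy c) ⊤ z∈
    ... | k , _ , refl = x∈p∩q⁺ (copy-fibre⁺ (subst (c ∈_) (sym X₀v≡) c∈) , copy∈U c k)

    back : A ∪ B ⊆ X C v ∩ U
    back z∈ with x∈p∪q⁻ A B z∈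
    ... | inj₁ z∈A = copies⊆ (x∈p∪q⁺ (inj₁ (x∈⁅x⁆ a))) z∈A
    ... | inj₂ z∈B = copies⊆ (x∈p∪q⁺ (inj₂ (x∈⁅x⁆ b))) z∈B

module GInflated {G} {C : Cover G} {U} (R : RestrictsToInflation IsGCover C U) where
  open Inflated R public

  private
    gcover : IsGCover C₀
    gcover = proj₁ (proj₂ (proj₂ (proj₂ (proj₂ R))))
    centre = proj₁ gcover
    X₀≡ = proj₁ (proj₂ gcover)
    μ₀ = proj₂ (proj₂ gcover)

  ∣fibre∣ : ∀ v → ∣ X C v ∩ U ∣ ≡ s
  ∣fibre∣ v = ∣fibre∣-single (X₀≡ v)

  μ-scaled : ∀ {u v x y} → u ≢ v → x ∈ X C u → y ∈ X C v → x ∈ U → y ∈ U →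
             μ (H C) x y * s ≡ μ G u v
  μ-scaled {u} {v} u≢v x∈u y∈v x∈U y∈U with copy-surjective x∈U | copy-surjective y∈U
  ... | a , k , refl | b , l , refl
    with x∈⁅y⁆⇒x≡y (centre u) (subst (a ∈_) (X₀≡ u) (copy-fibre⁻ x∈u))
       | x∈⁅y⁆⇒x≡y (centre v) (subst (b ∈_) (X₀≡ v) (copy-fibre⁻ y∈v))
  ... | refl | refl = trans (μ-copy _ _ k l) (μ₀ u v u≢v)

module _ {C : Configuration} {U} (R : RestrictsToInflation IsGCover (cover C) U)
         {τ} (τ∈ : Selector C τ) where
  open GInflated R

  selected-degree : ∀ W v → (∀ u → u ∈ W → τ u ∈ U) → v ∈ W →
                    sumOver W (λ u → μ (Hᶜ C) (τ v) (τ u)) * s ≡ sumOver W (μ (G C) v)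
  selected-degree W v W⊆U v∈W = trans (sumOver-distribʳ-* _ W s) (sumOver-cong W scaled)
    where
    scaled : ∀ u → u ∈ W → μ (Hᶜ C) (τ v) (τ u) * s ≡ μ (G C) v u
    scaled u u∈W with v ≟ u
    ... | yes refl = trans (cong (_* s) (loopless (Hᶜ C) (τ v))) (sym (loopless (G C) v))
    ... | no v≢u   = μ-scaled v≢u (τ∈ v) (τ∈ u) (W⊆U v v∈W) (W⊆U u u∈W)

  degree-obstruction : ∀ W (c : V (G C) → ℕ) → Nonempty W → (∀ u → u ∈ W → τ u ∈ U) →
    (∀ v → v ∈ W → f C (τ v) * ∣ Xᶜ C v ∩ U ∣ ≡ c v) →
    (∀ v → v ∈ W → c v ≤ sumOver W (μ (G C) v)) → Obstruction C τ
  degree-obstruction W c W≢∅ W⊆U f-inside c≤ = W , W≢∅ , λ v v∈W →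
    *-cancelʳ-≤ _ _ s ⦃ >-nonZero s≥1 ⦄ (begin
      f C (τ v) * s                                     ≡⟨ cong (f C (τ v) *_) (∣fibre∣ v) ⟨
      f C (τ v) * ∣ Xᶜ C v ∩ U ∣                        ≡⟨ f-inside v v∈W ⟩
      c v                                               ≤⟨ c≤ v v∈W ⟩
      sumOver W (μ (G C) v)                             ≡⟨ selected-degree W v W⊆U v∈W ⟨
      sumOver W (λ u → μ (Hᶜ C) (τ v) (τ u)) * s        ∎)
    where open ≤-Reasoning

sumOver-∩-average : ∀ {C : Configuration} {P U} → RestrictsToInflation P (cover C) U → ∀ {v c} →
  (∀ x → x ∈ Xᶜ C v → x ∈ U → f C x * ∣ Xᶜ C v ∩ U ∣ ≡ c) → sumOver (Xᶜ C v ∩ U) (f C) ≡ c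
sumOver-∩-average {C} {P} {U} R {v} f-inside = sumOver-average (fibre-nonempty {P = P} R v) λ x x∈ →
  let x∈X , x∈U = x∈p∩q⁻ (Xᶜ C v) U x∈ in f-inside x x∈X x∈U

sumOver-support : ∀ {n} {f : Fin n → ℕ} S U → (∀ x → x ∉ U → f x ≡ 0) →
                  sumOver S f ≡ sumOver (S ∩ U) f
sumOver-support {f = f} S U f≡0 = sumOver-shrink f (p∩q⊆p S U) λ x x∈S x∉ →
  f≡0 x λ x∈U → x∉ (x∈p∩q⁺ (x∈S , x∈U))

support-∈ : ∀ {n} {f : Fin n → ℕ} U → (∀ x → x ∉ U → f x ≡ 0) → ∀ {x} → f x ≢ 0 → x ∈ U
support-∈ U f≡0 {x} fx≢0 with x ∈? U
... | yes x∈U = x∈U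
... | no x∉U  = contradiction (f≡0 x x∉U) fx≢0

-- M-configurations

module _ {C} (M : MConfiguration C) where
  open MConfiguration M

  M-balanced : Balanced C
  M-balanced v = trans (sumOver-support (Xᶜ C v) U f-outside)
    (sumOver-∩-average {C} inflation (f-inside v))

  M-obstructed : Obstructed C
  M-obstructed τ τ∈ = obstructed-if-positive {C} λ positive →
    let τ∈U = λ v → support-∈ U f-outside (positive v) in
    degree-obstruction {C} inflation τ∈ ⊤ (degree (G C))
      (fromℕ< (proj₁ (proj₁ block)) , ∈⊤) (λ u _ → τ∈U u)
      (λ v _ → f-inside v (τ v) (τ∈ v) (τ∈U v))
      (λ v _ → ≤-reflexive (sym (sumOver-⊤ (μ (G C) v))))

-- K-configurations

sumOver-partition : ∀ {n p} {f : Fin n → ℕ} (S : Subset n) (U : Fin p → Subset n) →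
  (∀ i j → i ≢ j → Empty (U i ∩ U j)) → (∀ x → (∀ i → x ∉ U i) → f x ≡ 0) →
  sumOver S f ≡ sum λ i → sumOver (S ∩ U i) f
sumOver-partition {f = f} S U U-disj f≡0 =
  trans (sum-cong-≗ pointwise) (∑-comm λ x i → restrict (S ∩ U i) f x)
  where
  inside : ∀ {x} i → x ∈ U i → restrict S f x ≡ restrict (S ∩ U i) f x
  inside {x} i x∈U with x ∈? S
  ... | yes x∈S = trans (restrict-∈ {f = f} x∈S) (sym (restrict-∈ {f = f} (x∈p∩q⁺ (x∈S , x∈U))))
  ... | no  x∉S = trans (restrict-∉ {f = f} x∉S)
    (sym (restrict-∉ {S = S ∩ U i} {f = f} (x∉S ∘ p∩q⊆p S (U i))))

  pointwise : ∀ x → restrict S f x ≡ sum λ i → restrict (S ∩ U i) f x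
  pointwise x with any? (λ i → x ∈? U i)
  ... | yes (i , x∈Ui) = trans (inside i x∈Ui) (sym (sum-single i λ j j≢i →
    restrict-∉ {S = S ∩ U j} {f = f} λ x∈ →
      U-disj j i j≢i (x , x∈p∩q⁺ (p∩q⊆q S (U j) x∈ , x∈Ui))))
  ... | no x∉ = trans vanish (sym (sum-zero λ i →
    restrict-∉ {S = S ∩ U i} {f = f} λ x∈ → x∉ (i , p∩q⊆q S (U i) x∈)))
    where
    vanish : restrict S f x ≡ 0
    vanish with lookup S x
    ... | true  = f≡0 x λ i x∈ → x∉ (i , x∈)
    ... | false = refl

sumOver-except : ∀ {n} {d : Fin n → ℕ} {t} W v → v ∈ W → d v ≡ 0 → (∀ u → u ≢ v → d u ≡ t) →
                 sumOver W d + t ≡ ∣ W ∣ * t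
sumOver-except {n} {d} {t} W v v∈W dv≡0 d≡t = begin
  sumOver W d + t             ≡⟨ cong (sumOver W d +_) Σδ≡t ⟨
  sumOver W d + sumOver W δ   ≡⟨ sumOver-distrib-+ W ⟨
  sumOver W (λ u → d u + δ u) ≡⟨ sumOver-cong W (λ u _ → const-t u) ⟩
  sumOver W (const t)         ≡⟨ sumOver-const W t ⟩
  ∣ W ∣ * t                   ∎
  where
  open ≡-Reasoning
  δ : Fin n → ℕ
  δ = restrict ⁅ v ⁆ (const t)

  δv≡t : δ v ≡ t
  δv≡t = restrict-∈ {f = const t} (x∈⁅x⁆ v)

  Σδ≡t : sumOver W δ ≡ t
  Σδ≡t = trans
    (sumOver-shrink δ {A = ⁅ v ⁆} (λ u∈ → subst (_∈ W) (sym (x∈⁅y⁆⇒x≡y v u∈)) v∈W)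
      λ u _ u∉ → restrict-∉ {f = const t} u∉)
    (trans (sumOver-⁅⁆ δ v) δv≡t)

  const-t : ∀ u → d u + δ u ≡ t
  const-t u with u ≟ v
  ... | yes refl = cong₂ _+_ dv≡0 δv≡t
  ... | no u≢v   = trans (cong₂ _+_ (d≡t u u≢v) (restrict-∉ {f = const t} (x≢y⇒x∉⁅y⁆ u≢v)))
                         (+-identityʳ t)

≤-sum : ∀ {n} (g : Fin n → ℕ) i → g i ≤ sum g
≤-sum g i = subst (g i ≤_) (sumOver-⊤ g) (sumOver-∈ g ∈⊤)

μ-transport : ∀ {A B} (σ : A ≅ B) u v → let σ⁻¹ = Inverse.from (_≅_.bijection σ) in
              μ B u v ≡ μ A (σ⁻¹ u) (σ⁻¹ v)
μ-transport {B = B} σ u v = trans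
  (sym (cong₂ (μ B) (Inverse.strictlyInverseˡ bijection u) (Inverse.strictlyInverseˡ bijection v)))
  (μ-pres _ _)
  where open _≅_ σ

module _ {C} (K : KConfiguration C) where
  open KConfiguration K

  private
    μ≡t : ∀ v u → u ≢ v → μ (G C) v u ≡ t
    μ≡t v u u≢v = trans (μ-transport G≅tKₙ v u) distinct
      where
      v′ = Inverse.from (_≅_.bijection G≅tKₙ) v
      u′ = Inverse.from (_≅_.bijection G≅tKₙ) u
      distinct : μ (t · complete n) v′ u′ ≡ t
      distinct with v′ ≟ u′
      ... | yes v′≡u′ = contradiction
        (sym (↔-injective (↔-sym (_≅_.bijection G≅tKₙ)) v′≡u′)) u≢v
      ... | no _ = *-identityʳ t

    ∣V∣≡n : order (G C) ≡ n
    ∣V∣≡n = sym (↔⇒≡ (_≅_.bijection G≅tKₙ))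

    degree-within : ∀ W v → v ∈ W → sumOver W (μ (G C) v) + t ≡ ∣ W ∣ * t
    degree-within W v v∈W = sumOver-except W v v∈W (loopless (G C) v) (μ≡t v)

    suc[n∸1]≡n : suc (n ∸ 1) ≡ n
    suc[n∸1]≡n = m+[n∸m]≡n n≥1

    degree≡ : ∀ v → degree (G C) v ≡ t * (n ∸ 1)
    degree≡ v = +-cancelʳ-≡ t _ _ (begin
      degree (G C) v + t              ≡⟨ cong (_+ t) (sumOver-⊤ (μ (G C) v)) ⟨
      sumOver ⊤ (μ (G C) v) + t       ≡⟨ degree-within ⊤ v ∈⊤ ⟩
      ∣ ⊤ {order (G C)} ∣ * t         ≡⟨ cong (_* t) (trans (∣⊤∣≡n _) ∣V∣≡n) ⟩
      n * t                           ≡⟨ cong (_* t) suc[n∸1]≡n ⟨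
      t + (n ∸ 1) * t                 ≡⟨ +-comm t _ ⟩
      (n ∸ 1) * t + t                 ≡⟨ cong (_+ t) (*-comm (n ∸ 1) t) ⟩
      t * (n ∸ 1) + t                 ∎)
      where open ≡-Reasoning

  K-balanced : Balanced C
  K-balanced v = begin
    sumOver (Xᶜ C v) (f C)                      ≡⟨ sumOver-partition (Xᶜ C v) U U-disj f-outside ⟩
    (sum λ i → sumOver (Xᶜ C v ∩ U i) (f C))    ≡⟨ sum-cong-≗ (λ i → sumOver-∩-average {C} (inflation i) (f-inside i v)) ⟩
    (sum λ i → t * ns i)                        ≡⟨ *-distribˡ-sum t ns ⟨
    t * sum ns                                  ≡⟨ cong (t *_) Σns ⟩
    t * (n ∸ 1)                                 ≡⟨ degree≡ v ⟨
    degree (G C) v                              ∎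
    where open ≡-Reasoning

  K-obstructed : Obstructed C
  K-obstructed τ τ∈ = obstructed-if-positive {C} pigeonhole
    where
    chosenFrom? : ∀ i v → Dec (τ v ∈ U i)
    chosenFrom? i v = τ v ∈? U i

    W : Fin p → VSet (G C)
    W i = comprehension (chosenFrom? i)

    overfull : ∀ i → ns i < ∣ W i ∣ → Obstruction C τ
    overfull i ns<∣W∣ = degree-obstruction {C} (inflation i) τ∈ (W i) (const (t * ns i)) W≢∅
      (λ u → comprehension⁻ (chosenFrom? i))
      (λ v v∈W → f-inside i v (τ v) (τ∈ v) (comprehension⁻ (chosenFrom? i) v∈W))
      enough
      where
      W≢∅ : Nonempty (W i)
      W≢∅ with nonempty? (W i)
      ... | yes W≢∅ = W≢∅
      ... | no W≡∅ = contradiction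
        (subst (ns i <_) (trans (cong ∣_∣ (Empty-unique W≡∅)) (∣⊥∣≡0 (order (G C)))) ns<∣W∣) λ ()

      enough : ∀ v → v ∈ W i → t * ns i ≤ sumOver (W i) (μ (G C) v)
      enough v v∈W = +-cancelʳ-≤ t _ _ (begin
        t * ns i + t                     ≡⟨ +-comm (t * ns i) t ⟩
        t + t * ns i                     ≡⟨ *-suc t (ns i) ⟨
        t * suc (ns i)                   ≤⟨ *-monoʳ-≤ t ns<∣W∣ ⟩
        t * ∣ W i ∣                      ≡⟨ *-comm t _ ⟩
        ∣ W i ∣ * t                      ≡⟨ degree-within (W i) v v∈W ⟨
        sumOver (W i) (μ (G C) v) + t    ∎)
        where open ≤-Reasoning

    pigeonhole : (∀ v → f C (τ v) ≢ 0) → Obstruction C τ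
    pigeonhole positive with any? (λ i → ns i <? ∣ W i ∣)
    ... | yes (i , ns<∣W∣) = overfull i ns<∣W∣
    ... | no none = contradiction covered (<⇒≱ too-few)
      where
      open ≤-Reasoning

      member : ∀ v → 1 ≤ sum λ i → restrict (W i) (const 1) v
      member v with any? (λ i → chosenFrom? i v)
      ... | yes (i , τv∈U) = ≤-trans
        (≤-reflexive (sym (restrict-∈ {f = const 1} (comprehension⁺ (chosenFrom? i) τv∈U))))
        (≤-sum (λ i → restrict (W i) (const 1) v) i)
      ... | no τv∉U = contradiction (f-outside (τ v) λ i τv∈U → τv∉U (i , τv∈U)) (positive v)

      covered : order (G C) ≤ sum λ i → ∣ W i ∣
      covered = begin
        order (G C)                                        ≡⟨ trans (sym (∣⊤∣≡n (order (G C)))) (trans (∣S∣-as-sum (⊤ {order (G C)})) (sumOver-⊤ {order (G C)} (const 1))) ⟩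
        sum {order (G C)} (const 1)                        ≤⟨ sum-mono member ⟩
        (sum λ v → sum λ i → restrict (W i) (const 1) v)   ≡⟨ ∑-comm (λ v i → restrict (W i) (const 1) v) ⟩
        (sum λ i → sumOver (W i) (const 1))                ≡⟨ sum-cong-≗ (λ i → sym (∣S∣-as-sum (W i))) ⟩
        (sum λ i → ∣ W i ∣)                                ∎

      too-few : (sum λ i → ∣ W i ∣) < order (G C)
      too-few = begin-strict
        (sum λ i → ∣ W i ∣)   ≤⟨ sum-mono (λ i → ≮⇒≥ λ ns<∣W∣ → none (i , ns<∣W∣)) ⟩
        sum ns                ≡⟨ Σns ⟩
        n ∸ 1                 <⟨ n<1+n _ ⟩
        suc (n ∸ 1)           ≡⟨ suc[n∸1]≡n ⟩
        n                     ≡⟨ ∣V∣≡n ⟨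
        order (G C)           ∎

-- Cycles

alternate : Bool → ℕ → Bool
alternate b zero    = b
alternate b (suc m) = not (alternate b m)

alternate-+2* : ∀ b m q → alternate b (m + q * 2) ≡ alternate b m
alternate-+2* b m zero    = cong (alternate b) (+-identityʳ m)
alternate-+2* b m (suc q) = begin
  alternate b (m + suc (suc (q * 2)))     ≡⟨ cong (alternate b) (+-suc m _) ⟩
  not (alternate b (m + suc (q * 2)))     ≡⟨ cong (not ∘ alternate b) (+-suc m _) ⟩
  not (not (alternate b (m + q * 2)))     ≡⟨ not-involutive _ ⟩
  alternate b (m + q * 2)                 ≡⟨ alternate-+2* b m q ⟩
  alternate b m                           ∎
  where open ≡-Reasoning

alternate-even : ∀ {m} b → 2 ∣ m → alternate b m ≡ b
alternate-even b (divides q refl) = alternate-+2* b 0 q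

alternate-odd : ∀ {m} b → 2 ∤ m → alternate b m ≡ not b
alternate-odd {m} b 2∤m = trans (cong (alternate b) (m≡m%n+[m/n]*n m 2))
  (trans (alternate-+2* b (m % 2) (m / 2)) (cong (alternate b) m%2≡1))
  where
  m%2≡1 : m % 2 ≡ 1
  m%2≡1 with m % 2 in eq | m%n<n m 2
  ... | 0 | _ = contradiction (m%n≡0⇒n∣m m 2 eq) 2∤m
  ... | 1 | _ = refl
  ... | suc (suc _) | s≤s (s≤s ())

Repeats : (ℕ → Bool → Set) → Set
Repeats R = ∃[ k ] ∃[ b ] (R k b × R (suc k) b)

repeats-or-alternates : ∀ {R : ℕ → Bool → Set} {b} m → (∀ k → k ≤ m → ∃[ c ] R k c) → R 0 b →
                        Repeats R ⊎ R m (alternate b m)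
repeats-or-alternates zero total r₀ = inj₂ r₀
repeats-or-alternates {R} {b} (suc m) total r₀
  with repeats-or-alternates {R} m (λ k k≤m → total k (m≤n⇒m≤1+n k≤m)) r₀ | total (suc m) ≤-refl
... | inj₁ rep | _ = inj₁ rep
... | inj₂ rₘ | c , r with alternate b m in eq | c
... | true  | true  = inj₁ (m , true , rₘ , r)
... | false | false = inj₁ (m , false , rₘ , r)
... | true  | false = inj₂ r
... | false | true  = inj₂ r

[m%n+k]%n≡[m+k]%n : ∀ m k n .{{_ : NonZero n}} → (m % n + k) % n ≡ (m + k) % n
[m%n+k]%n≡[m+k]%n m k n = begin
  (m % n + k) % n           ≡⟨ %-distribˡ-+ (m % n) k n ⟩
  (m % n % n + k % n) % n   ≡⟨ cong (λ a → (a + k % n) % n) (m%n%n≡m%n m n) ⟩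
  (m % n + k % n) % n       ≡⟨ %-distribˡ-+ m k n ⟨
  (m + k) % n               ∎
  where open ≡-Reasoning

[1+m%n]%n≡[1+m]%n : ∀ m n .{{_ : NonZero n}} → suc (m % n) % n ≡ suc m % n
[1+m%n]%n≡[1+m]%n m n = trans (cong (_% n) (+-comm 1 (m % n)))
  (trans ([m%n+k]%n≡[m+k]%n m 1 n) (cong (_% n) (+-comm m 1)))

toℕ-mod : ∀ k n .{{_ : NonZero n}} → toℕ (k mod n) ≡ k % n
toℕ-mod k n = toℕ-fromℕ< (m%n<n k n)

mod-cong : ∀ {k l} n .{{_ : NonZero n}} → k % n ≡ l % n → k mod n ≡ l mod n
mod-cong {k} {l} n eq = toℕ-injective (trans (toℕ-mod k n) (trans eq (sym (toℕ-mod l n))))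

toℕ-%-cancel : ∀ {n} .{{_ : NonZero n}} (i : Fin n) → toℕ i % n ≡ toℕ i
toℕ-%-cancel i = m<n⇒m%n≡m (toℕ<n i)

suc-mod : ∀ k n .{{_ : NonZero n}} → suc (toℕ (k mod n)) % n ≡ toℕ (suc k mod n)
suc-mod k n = begin
  suc (toℕ (k mod n)) % n   ≡⟨ cong (λ a → suc a % n) (toℕ-mod k n) ⟩
  suc (k % n) % n           ≡⟨ [1+m%n]%n≡[1+m]%n k n ⟩
  suc k % n                 ≡⟨ toℕ-mod (suc k) n ⟨
  toℕ (suc k mod n)         ∎
  where open ≡-Reasoning

mod-adjacent : ∀ k n .{{_ : NonZero n}} → CyclicallyAdjacent (k mod n) (suc k mod n)
mod-adjacent k n = inj₁ (suc-mod k n)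

module Cycle {G t n n≥3} (σ : t · cycle n n≥3 ≅ G) where

  private
    instance
      n≢0 : NonZero n
      n≢0 = >-nonZero (≤-trans (s≤s z≤n) n≥3)

    to = Inverse.to (_≅_.bijection σ)

  point : ℕ → V G
  point k = to (k mod n)

  point-wrap : point n ≡ point 0
  point-wrap = cong to (mod-cong n ([m+n]%n≡m%n 0 n))

  μ-adjacent : ∀ {i j} → CyclicallyAdjacent i j → μ G (to i) (to j) ≡ t
  μ-adjacent {i} {j} adj = trans (_≅_.μ-pres σ i j)
    (trans (cong (λ b → t * (if b then 1 else 0)) (dec-true (cyclicallyAdjacent? i j) adj))
           (*-identityʳ t))

  μ-step : ∀ k → μ G (point k) (point (suc k)) ≡ t
  μ-step k = μ-adjacent (mod-adjacent k n)

  point-step : t ≥ 1 → ∀ k → point k ≢ point (suc k)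
  point-step t≥1 k eq = <⇒≢ t≥1 (trans (sym (loopless G (point k)))
    (trans (cong (μ G (point k)) eq) (μ-step k)))

  private
    no-return : ∀ i → i < n → suc (suc i % n) % n ≢ i
    no-return i i<n eq with m≤n⇒m<n∨m≡n i<n
    ... | inj₂ refl = contradiction (subst (3 ≤_) (cong suc i≡1) n≥3) λ { (s≤s (s≤s ())) }
      where
      i≡1 : i ≡ 1
      i≡1 = trans (sym eq) (trans (cong (λ a → suc a % n) (n%n≡0 n))
        (m<n⇒m%n≡m (≤-trans (s≤s (s≤s z≤n)) n≥3)))
    ... | inj₁ 1+i<n with m≤n⇒m<n∨m≡n 1+i<n | cong (λ a → suc a % n) (m<n⇒m%n≡m 1+i<n)
    ...   | inj₁ 2+i<n | step = m+1+n≢n 1 (trans (sym (m<n⇒m%n≡m 2+i<n)) (trans (sym step) eq))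
    ...   | inj₂ refl  | step = contradiction (subst (λ a → 3 ≤ suc (suc a)) i≡0 n≥3) λ { (s≤s (s≤s ())) }
      where
      i≡0 : i ≡ 0
      i≡0 = trans (sym eq) (trans step (n%n≡0 n))

    module _ (i : Fin n) where
      open ≡-Reasoning

      next prev : Fin n
      next = suc (toℕ i) mod n
      prev = (toℕ i + (n ∸ 1)) mod n

      private
        suc-n∸1 : ∀ a → suc (a + (n ∸ 1)) ≡ a + n
        suc-n∸1 a = trans (sym (+-suc a (n ∸ 1))) (cong (a +_) (m+[n∸m]≡n (≤-trans (s≤s z≤n) n≥3)))

        suc-next : suc (toℕ i) % n ≡ toℕ next
        suc-next = sym (toℕ-mod (suc (toℕ i)) n)

        suc-prev : suc (toℕ prev) % n ≡ toℕ i
        suc-prev = begin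
          suc (toℕ prev) % n                    ≡⟨ cong (λ a → suc a % n) (toℕ-mod (toℕ i + (n ∸ 1)) n) ⟩
          suc ((toℕ i + (n ∸ 1)) % n) % n       ≡⟨ [1+m%n]%n≡[1+m]%n (toℕ i + (n ∸ 1)) n ⟩
          suc (toℕ i + (n ∸ 1)) % n             ≡⟨ cong (_% n) (suc-n∸1 (toℕ i)) ⟩
          (toℕ i + n) % n                       ≡⟨ [m+n]%n≡m%n (toℕ i) n ⟩
          toℕ i % n                             ≡⟨ toℕ-%-cancel i ⟩
          toℕ i                                 ∎

        prev-unique : ∀ {w : Fin n} → suc (toℕ w) % n ≡ toℕ i → w ≡ prev
        prev-unique {w} eq = toℕ-injective (begin
          toℕ w                               ≡⟨ toℕ-%-cancel w ⟨
          toℕ w % n                           ≡⟨ [m+n]%n≡m%n (toℕ w) n ⟨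
          (toℕ w + n) % n                     ≡⟨ cong (_% n) (suc-n∸1 (toℕ w)) ⟨
          (suc (toℕ w) + (n ∸ 1)) % n         ≡⟨ [m%n+k]%n≡[m+k]%n (suc (toℕ w)) (n ∸ 1) n ⟨
          (suc (toℕ w) % n + (n ∸ 1)) % n     ≡⟨ cong (λ a → (a + (n ∸ 1)) % n) eq ⟩
          (toℕ i + (n ∸ 1)) % n               ≡⟨ toℕ-mod (toℕ i + (n ∸ 1)) n ⟨
          toℕ prev                            ∎)

      next≢prev : next ≢ prev
      next≢prev next≡prev = no-return (toℕ i) (toℕ<n i) (begin
        suc (suc (toℕ i) % n) % n   ≡⟨ cong (λ a → suc a % n) (toℕ-mod (suc (toℕ i)) n) ⟨
        suc (toℕ next) % n          ≡⟨ cong (λ w → suc (toℕ w) % n) next≡prev ⟩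
        suc (toℕ prev) % n          ≡⟨ suc-prev ⟩
        toℕ i                       ∎)

      adjacent-next : CyclicallyAdjacent i next
      adjacent-next = inj₁ suc-next

      adjacent-prev : CyclicallyAdjacent i prev
      adjacent-prev = inj₂ suc-prev

      adjacent-only : ∀ {w} → CyclicallyAdjacent i w → w ∈ ⁅ next ⁆ ∪ ⁅ prev ⁆
      adjacent-only {w} (inj₁ eq) = x∈p∪q⁺ (inj₁ (subst (_∈ ⁅ next ⁆)
        (toℕ-injective (trans (sym suc-next) eq)) (x∈⁅x⁆ next)))
      adjacent-only {w} (inj₂ eq) = x∈p∪q⁺ (inj₂ (subst (_∈ ⁅ prev ⁆)
        (sym (prev-unique eq)) (x∈⁅x⁆ prev)))

  degree-cycle : ∀ v → degree G v ≡ t + t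
  degree-cycle v = begin
    sum (μ G v)                         ≡⟨ sum-permute (μ G v) (_≅_.bijection σ) ⟩
    sum d                               ≡⟨ sumOver-⊤ d ⟨
    sumOver ⊤ d                         ≡⟨ sumOver-shrink d ⊆⊤ vanish ⟩
    sumOver (⁅ next i ⁆ ∪ ⁅ prev i ⁆) d ≡⟨ sumOver-∪ d ⁅ next i ⁆ ⁅ prev i ⁆ disjoint ⟩
    sumOver ⁅ next i ⁆ d + sumOver ⁅ prev i ⁆ d
      ≡⟨ cong₂ _+_ (sumOver-⁅⁆ d (next i)) (sumOver-⁅⁆ d (prev i)) ⟩
    d (next i) + d (prev i)             ≡⟨ cong₂ _+_ (d-adjacent (adjacent-next i)) (d-adjacent (adjacent-prev i)) ⟩
    t + t                               ∎
    where
    open ≡-Reasoning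
    i = Inverse.from (_≅_.bijection σ) v
    to-i : to i ≡ v
    to-i = Inverse.strictlyInverseˡ (_≅_.bijection σ) v

    d : Fin n → ℕ
    d = μ G v ∘ to

    d-adjacent : ∀ {w} → CyclicallyAdjacent i w → d w ≡ t
    d-adjacent {w} adj = trans (cong (λ u → μ G u (to w)) (sym to-i)) (μ-adjacent adj)

    vanish : ∀ w → w ∈ ⊤ → w ∉ ⁅ next i ⁆ ∪ ⁅ prev i ⁆ → d w ≡ 0
    vanish w _ w∉ = begin
      μ G v (to w)                  ≡⟨ cong (λ u → μ G u (to w)) to-i ⟨
      μ G (to i) (to w)             ≡⟨ _≅_.μ-pres σ i w ⟩
      t * (if does (cyclicallyAdjacent? i w) then 1 else 0)
        ≡⟨ cong (λ b → t * (if b then 1 else 0)) (dec-false (cyclicallyAdjacent? i w) (w∉ ∘ adjacent-only i)) ⟩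
      t * 0                         ≡⟨ *-zeroʳ t ⟩
      0                             ∎

    disjoint : ∀ w → w ∈ ⁅ next i ⁆ → w ∈ ⁅ prev i ⁆ → d w ≡ 0
    disjoint w w∈ w∈′ = contradiction
      (trans (sym (x∈⁅y⁆⇒x≡y (next i) w∈)) (x∈⁅y⁆⇒x≡y (prev i) w∈′)) (next≢prev i)

module _ {C} (O : OddCConfiguration C) where
  open OddCConfiguration O
  open Cycle {t = t} {n≥3 = n≥3} G≅tCₙ

  oddC-balanced : Balanced C
  oddC-balanced v = begin
    sumOver Xv (f C)                                    ≡⟨ sumOver-support Xv (U₁ ∪ U₂) (λ x x∉ → f-outside x (x∉ ∘ p⊆p∪q U₂) (x∉ ∘ q⊆p∪q U₁ U₂)) ⟩
    sumOver (Xv ∩ (U₁ ∪ U₂)) (f C)                      ≡⟨ cong (λ S → sumOver S (f C)) (∩-distribˡ-∪ Xv U₁ U₂) ⟩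
    sumOver ((Xv ∩ U₁) ∪ (Xv ∩ U₂)) (f C)               ≡⟨ sumOver-∪ (f C) (Xv ∩ U₁) (Xv ∩ U₂) disjoint ⟩
    sumOver (Xv ∩ U₁) (f C) + sumOver (Xv ∩ U₂) (f C)
      ≡⟨ cong₂ _+_ (sumOver-∩-average {C} inflation₁ (f-inside₁ v)) (sumOver-∩-average {C} inflation₂ (f-inside₂ v)) ⟩
    t + t                                               ≡⟨ degree-cycle v ⟨
    degree (G C) v                                      ∎
    where
    open ≡-Reasoning
    Xv = Xᶜ C v
    disjoint : ∀ x → x ∈ Xv ∩ U₁ → x ∈ Xv ∩ U₂ → f C x ≡ 0
    disjoint x x∈₁ x∈₂ = contradiction
      (x , x∈p∩q⁺ (p∩q⊆q Xv U₁ x∈₁ , p∩q⊆q Xv U₂ x∈₂)) U-disj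

  oddC-obstructed : Obstructed C
  oddC-obstructed τ τ∈ = obstructed-if-positive {C} λ positive →
    cases λ k → choice (point k) (positive (point k))
    where
    part : Bool → VSet (Hᶜ C)
    part true  = U₁
    part false = U₂

    inflation : ∀ b → RestrictsToInflation IsGCover (cover C) (part b)
    inflation true  = inflation₁
    inflation false = inflation₂

    f-inside : ∀ b v x → x ∈ Xᶜ C v → x ∈ part b → f C x * ∣ Xᶜ C v ∩ part b ∣ ≡ t
    f-inside true  = f-inside₁
    f-inside false = f-inside₂

    exclusive : ∀ b {x} → x ∈ part b → x ∉ part (not b)
    exclusive true  x∈₁ x∈₂ = U-disj (_ , x∈p∩q⁺ (x∈₁ , x∈₂))
    exclusive false x∈₂ x∈₁ = U-disj (_ , x∈p∩q⁺ (x∈₁ , x∈₂))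

    choice : ∀ v → f C (τ v) ≢ 0 → ∃[ b ] (τ v ∈ part b)
    choice v fv≢0 with τ v ∈? U₁ | τ v ∈? U₂
    ... | yes ∈₁ | _      = true , ∈₁
    ... | no  _  | yes ∈₂ = false , ∈₂
    ... | no ∉₁  | no ∉₂  = contradiction (f-outside (τ v) ∉₁ ∉₂) fv≢0

    R : ℕ → Bool → Set
    R k b = τ (point k) ∈ part b

    step : Repeats R → Obstruction C τ
    step (k , b , r , r′) = pair-obstruction {C} (point k) (point (suc k))
      (f≤μ (point k) r) (f≤μ (point (suc k)) r′)
      where
      open GInflated (inflation b)
      open ≤-Reasoning

      f≤μ : ∀ v → τ v ∈ part b → f C (τ v) ≤ μ (Hᶜ C) (τ (point k)) (τ (point (suc k)))
      f≤μ v τv∈ = *-cancelʳ-≤ _ _ s ⦃ >-nonZero s≥1 ⦄ (begin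
        f C (τ v) * s                                             ≡⟨ cong (f C (τ v) *_) (∣fibre∣ v) ⟨
        f C (τ v) * ∣ Xᶜ C v ∩ part b ∣                           ≡⟨ f-inside b v (τ v) (τ∈ v) τv∈ ⟩
        t                                                         ≡⟨ μ-step k ⟨
        μ (G C) (point k) (point (suc k))                         ≡⟨ μ-scaled (point-step t≥1 k) (τ∈ _) (τ∈ _) r r′ ⟨
        μ (Hᶜ C) (τ (point k)) (τ (point (suc k))) * s            ∎)

    cases : (∀ k → ∃[ b ] R k b) → Obstruction C τ
    cases total with total 0
    ... | b , r₀ with repeats-or-alternates {R} n (λ k _ → total k) r₀
    ...   | inj₁ rep = step rep
    ...   | inj₂ rₙ  = contradiction
      (subst (λ v → τ v ∈ part (not b)) point-wrap (subst (R n) (alternate-odd b n-odd) rₙ))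
      (exclusive b r₀)

module _ {C} (E : EvenCConfiguration C) where
  open EvenCConfiguration E
  open Cycle {t = t} {n≥3 = n≥3} G≅tCₙ
  open Inflated inflation

  private
    instance
      n≢0 : NonZero n
      n≢0 = >-nonZero (≤-trans (s≤s z≤n) n≥3)

      n+n≢0 : NonZero (n + n)
      n+n≢0 = >-nonZero (≤-trans (≤-trans (s≤s z≤n) n≥3) (m≤m+n n n))

    double : IsDoubleCover t n n≥3 G≅tCₙ C₀
    double = proj₁ (proj₂ (proj₂ (proj₂ (proj₂ inflation))))
    x = proj₁ double
    x-injective = proj₁ (proj₂ double)
    X₀≡ = proj₁ (proj₂ (proj₂ double))
    μ₀≡t = proj₁ (proj₂ (proj₂ (proj₂ double)))

    ↑ˡ≢↑ʳ : ∀ {i : Fin n} → i ↑ˡ n ≢ n ↑ʳ i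
    ↑ˡ≢↑ʳ {i} eq = <⇒≢ (≤-trans (toℕ<n i) (m≤m+n n (toℕ i)))
      (trans (sym (toℕ-↑ˡ i n)) (trans (cong toℕ eq) (toℕ-↑ʳ n i)))

    ∣fibre∣ : ∀ v → ∣ Xᶜ C v ∩ U ∣ ≡ s + s
    ∣fibre∣ v = subst (λ w → ∣ Xᶜ C w ∩ U ∣ ≡ s + s)
      (Inverse.strictlyInverseˡ (_≅_.bijection G≅tCₙ) v)
      (∣fibre∣-pair (↑ˡ≢↑ʳ ∘ x-injective) (X₀≡ (Inverse.from (_≅_.bijection G≅tCₙ) v)))

    -- Two sheets over the cycle: y k false and y k true index the two
    -- vertices of the double cover over the k-th vertex, each sheet advances by cyclic steps, and going once
    -- around the base cycle exchanges the sheets.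
    shift : ℕ → Bool → ℕ
    shift k b = if b then n + k else k

    y : ℕ → Bool → Fin (n + n)
    y k b = shift k b mod (n + n)

    y-adjacent : ∀ k b → CyclicallyAdjacent (y k b) (y (suc k) b)
    y-adjacent k false = mod-adjacent k (n + n)
    y-adjacent k true  = subst (λ a → CyclicallyAdjacent (y k true) (a mod (n + n)))
      (sym (+-suc n k)) (mod-adjacent (n + k) (n + n))

    y-wrap : ∀ b → y n b ≡ y 0 (not b)
    y-wrap false = cong (_mod (n + n)) (sym (+-identityʳ n))
    y-wrap true  = mod-cong (n + n) ([m+n]%n≡m%n 0 (n + n))

    n<n+n : n < n + n
    n<n+n = m<m+n n (≤-trans (s≤s z≤n) n≥3)

    y0-exclusive : ∀ b → y 0 b ≢ y 0 (not b)
    y0-exclusive false eq = y0-exclusive true (sym eq)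
    y0-exclusive true eq = ≢-nonZero⁻¹ n (begin
      n                       ≡⟨ m<n⇒m%n≡m n<n+n ⟨
      n % (n + n)             ≡⟨ cong (_% (n + n)) (+-identityʳ n) ⟨
      (n + 0) % (n + n)       ≡⟨ toℕ-mod (n + 0) (n + n) ⟨
      toℕ (y 0 true)          ≡⟨ cong toℕ eq ⟩
      toℕ (y 0 false)         ≡⟨ toℕ-mod 0 (n + n) ⟩
      0 % (n + n)             ≡⟨ m<n⇒m%n≡m (≤-trans (s≤s z≤n) n<n+n) ⟩
      0                       ∎)
      where open ≡-Reasoning

    toℕ-k-mod-n : ∀ {k} → k < n → toℕ (k mod n) ≡ k
    toℕ-k-mod-n {k} k<n = trans (toℕ-mod k n) (m<n⇒m%n≡m k<n)

    y-false : ∀ {k} → k < n → y k false ≡ (k mod n) ↑ˡ n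
    y-false {k} k<n = toℕ-injective (begin
      toℕ (y k false)        ≡⟨ toℕ-mod k (n + n) ⟩
      k % (n + n)            ≡⟨ m<n⇒m%n≡m (≤-trans k<n (m≤m+n n n)) ⟩
      k                      ≡⟨ toℕ-k-mod-n k<n ⟨
      toℕ (k mod n)          ≡⟨ toℕ-↑ˡ (k mod n) n ⟨
      toℕ ((k mod n) ↑ˡ n)   ∎)
      where open ≡-Reasoning

    y-true : ∀ {k} → k < n → y k true ≡ n ↑ʳ (k mod n)
    y-true {k} k<n = toℕ-injective (begin
      toℕ (y k true)         ≡⟨ toℕ-mod (n + k) (n + n) ⟩
      (n + k) % (n + n)      ≡⟨ m<n⇒m%n≡m (+-monoʳ-< n k<n) ⟩
      n + k                  ≡⟨ cong (n +_) (toℕ-k-mod-n k<n) ⟨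
      n + toℕ (k mod n)      ≡⟨ toℕ-↑ʳ n (k mod n) ⟨
      toℕ (n ↑ʳ (k mod n))   ∎)
      where open ≡-Reasoning

  evenC-balanced : Balanced C
  evenC-balanced v = begin
    sumOver (Xᶜ C v) (f C)          ≡⟨ sumOver-support (Xᶜ C v) U f-outside ⟩
    sumOver (Xᶜ C v ∩ U) (f C)      ≡⟨ sumOver-∩-average {C} inflation (f-inside v) ⟩
    2 * t                           ≡⟨ cong (t +_) (+-identityʳ t) ⟩
    t + t                           ≡⟨ degree-cycle v ⟨
    degree (G C) v                  ∎
    where open ≡-Reasoning

  evenC-obstructed : Obstructed C
  evenC-obstructed τ τ∈ = obstructed-if-positive {C} λ positive →
    cases λ v → support-∈ U f-outside (positive v)
    where
    R : ℕ → Bool → Set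
    R k b = ∃[ l ] copy (x (y k b)) l ≡ τ (point k)

    f*s≡t : ∀ v → τ v ∈ U → f C (τ v) * s ≡ t
    f*s≡t v τv∈U = *-cancelˡ-≡ _ _ 2 (begin
      2 * (f C (τ v) * s)               ≡⟨ cong (f C (τ v) * s +_) (+-identityʳ _) ⟩
      f C (τ v) * s + f C (τ v) * s     ≡⟨ *-distribˡ-+ (f C (τ v)) s s ⟨
      f C (τ v) * (s + s)               ≡⟨ cong (f C (τ v) *_) (∣fibre∣ v) ⟨
      f C (τ v) * ∣ Xᶜ C v ∩ U ∣        ≡⟨ f-inside v (τ v) (τ∈ v) τv∈U ⟩
      2 * t                             ∎)
      where open ≡-Reasoning

    step : (∀ v → τ v ∈ U) → Repeats R → Obstruction C τ
    step τ∈U (k , b , (l , r) , (l′ , r′)) =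
      pair-obstruction {C} (point k) (point (suc k)) (f≤μ (point k)) (f≤μ (point (suc k)))
      where
      open ≤-Reasoning

      f≤μ : ∀ v → f C (τ v) ≤ μ (Hᶜ C) (τ (point k)) (τ (point (suc k)))
      f≤μ v = *-cancelʳ-≤ _ _ s ⦃ >-nonZero s≥1 ⦄ (begin
        f C (τ v) * s                                                             ≡⟨ f*s≡t v (τ∈U v) ⟩
        t                                                                         ≡⟨ μ₀≡t _ _ (y-adjacent k b) ⟨
        μ (H C₀) (x (y k b)) (x (y (suc k) b))                                    ≡⟨ μ-copy _ _ l l′ ⟨
        μ (Hᶜ C) (copy (x (y k b)) l) (copy (x (y (suc k) b)) l′) * s             ≡⟨ cong₂ (λ z z′ → μ (Hᶜ C) z z′ * s) r r′ ⟩
        μ (Hᶜ C) (τ (point k)) (τ (point (suc k))) * s                            ∎)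

    total : (∀ v → τ v ∈ U) → ∀ k → k < n → ∃[ b ] R k b
    total τ∈U k k<n with copy-surjective (τ∈U (point k))
    ... | a , l , eq with x∈p∪q⁻ _ _ (subst (a ∈_) (X₀≡ (k mod n))
                            (copy-fibre⁻ (subst (_∈ Xᶜ C (point k)) (sym eq) (τ∈ (point k)))))
    ... | inj₁ a∈ = false , l , trans
      (cong (λ a → copy a l) (trans (cong x (y-false k<n)) (sym (x∈⁅y⁆⇒x≡y _ a∈)))) eq
    ... | inj₂ a∈ = true , l , trans
      (cong (λ a → copy a l) (trans (cong x (y-true k<n)) (sym (x∈⁅y⁆⇒x≡y _ a∈)))) eq

    unwrap : ∀ {b} → R n b → R 0 (not b)
    unwrap {b} (l , r) = l , trans (cong (λ p → copy (x p) l) (sym (y-wrap b))) (trans r (cong τ point-wrap))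

    wrap : ∀ {b} → R 0 b → R n (not b)
    wrap {b} (l , r) = l , trans
      (cong (λ p → copy (x p) l) (trans (y-wrap (not b)) (cong (y 0) (not-involutive b))))
      (trans r (cong τ (sym point-wrap)))

    exclusive : ∀ b → R 0 b → ¬ R 0 (not b)
    exclusive b (l , r) (l′ , r′) = y0-exclusive b
      (x-injective (cong proj₁ (copy-injective (trans r (sym r′)))))

    cases : (∀ v → τ v ∈ U) → Obstruction C τ
    cases τ∈U with total τ∈U 0 (≤-trans (s≤s z≤n) n≥3)
    ... | b , r₀ with repeats-or-alternates {R} n total≤ r₀
      where
      total≤ : ∀ k → k ≤ n → ∃[ c ] R k c
      total≤ k k≤n with m≤n⇒m<n∨m≡n k≤n
      ... | inj₁ k<n  = total τ∈U k k<n
      ... | inj₂ refl = not b , wrap r₀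
    ...   | inj₁ rep = step τ∈U rep
    ...   | inj₂ rₙ  = contradiction (unwrap (subst (R n) (alternate-even b n-even) rₙ)) (exclusive b r₀)

constructible-balanced : ∀ {C} → Constructible C → Balanced C
constructible-balanced (M-conf _ M)          = M-balanced M
constructible-balanced (K-conf _ K)          = K-balanced K
constructible-balanced (oddCConf _ O)        = oddC-balanced O
constructible-balanced (evenCConf _ E)       = evenC-balanced E
constructible-balanced (merge _ c₁ c₂ M)     =
  merge-balanced M (constructible-balanced c₁) (constructible-balanced c₂)

constructible-obstructed : ∀ {C} → Constructible C → Obstructed C
constructible-obstructed (M-conf _ M)          = M-obstructed M
constructible-obstructed (K-conf _ K)          = K-obstructed K
constructible-obstructed (oddCConf _ O)        = oddC-obstructed O
constructible-obstructed (evenCConf _ E)       = evenC-obstructed E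
constructible-obstructed (merge _ c₁ c₂ M)     =
  merge-obstructed M (constructible-obstructed c₁) (constructible-obstructed c₂)

proposition11 : (C : Configuration) → Constructible C →
    ((v : V (G C)) → sumOver (X (cover C) v) (f C) ≡ degree (G C) v) × Uncolorable C
proposition11 C c = constructible-balanced c , obstructed⇒uncolorable {C} (constructible-obstructed c)
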